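{- For every real $\alpha$ with $0<\alpha<\tfrac14$ there exists $k_0$ such that for all integers $k$ and $l$ satisfying $k\ge k_0$ and $k\le \alpha l$ we have \[ f(k,l)\le 2^{4k/(1-4\alpha)}. \]
   Context: For a graph $G$, write $G\rightarrow K_k$ if every coloring of the edges of $G$ with two colors yields a monochromatic copy of the complete graph $K_k$. For integers $k\ge 3$ and $l\ge k+1$, the relaxed Folkman number $f(k,l)$ is the minimum $n$ such that there exists a graph $G$ on $n$ vertices with $G\rightarrow K_k$ and $G$ containing no copy of $K_l$. -}

module Defs where

open import Data.Nat using (ℕ; _≤_; _<_; _*_; _^_; _∸_)
open import Data.Fin using (Fin)
open import Data.Bool using (Bool; true; false)
open import Data.Product using (Σ; ∃; ∃-syntax; _×_)
open import Relation.Nullary using (¬_)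
open import Relation.Binary.PropositionalEquality using (_≡_; _≢_)
open import Function.Definitions using (Injective)
open import Data.Integer as ℤ using (ℤ; +_; ∣_∣)
open import Data.Rational as ℚ using (ℚ; ↥_; ↧_; ↧ₙ_; _/_)

record Graph (n : ℕ) : Set where
  field
    adj    : Fin n → Fin n → Bool
    symm   : ∀ u v → adj u v ≡ adj v u
    irrefl : ∀ v → adj v v ≡ false
open Graph public

-- A 2-colouring of the edges of G: a colour for each (unordered) pair,
-- i.e. a symmetric Bool-valued function (its values on non-edges are irrelevant).
record TwoColouring {n : ℕ} (G : Graph n) : Set where
  field
    colour : Fin n → Fin n → Bool
    colour-symm : ∀ u v → colour u v ≡ colour v u
open TwoColouring public

record CliqueCopy {n : ℕ} (G : Graph n) (k : ℕ) : Set where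
  field
    emb     : Fin k → Fin n
    emb-inj : Injective _≡_ _≡_ emb
    edges   : ∀ i j → i ≢ j → adj G (emb i) (emb j) ≡ true
open CliqueCopy public

record MonoCliqueCopy {n : ℕ} (G : Graph n) (c : TwoColouring G) (k : ℕ) : Set where
  field
    copy : CliqueCopy G k
    col  : Bool
    mono : ∀ i j → i ≢ j → colour c (emb copy i) (emb copy j) ≡ col
open MonoCliqueCopy public

_⟶K_ : {n : ℕ} → Graph n → ℕ → Set
G ⟶K k = (c : TwoColouring G) → MonoCliqueCopy G c k

K-free : {n : ℕ} → Graph n → ℕ → Set
K-free G l = ¬ CliqueCopy G l

FolkmanGraphExists : ℕ → ℕ → ℕ → Set
FolkmanGraphExists k l n = Σ (Graph n) λ G → (G ⟶K k) × K-free G l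

IsFolkmanNumber : ℕ → ℕ → ℕ → Set
IsFolkmanNumber k l n =
  FolkmanGraphExists k l n × (∀ m → m < n → ¬ FolkmanGraphExists k l m)

-- Real numbers α with 0 < α < 1/4, represented by their (open) upper
-- Dedekind cut U = { q ∈ ℚ | α < q }.

record RealIn0¼ : Set₁ where
  field
    U        : ℚ → Set
    upward   : ∀ {p q} → U p → p ℚ.< q → U q
    rounded  : ∀ {q} → U q → ∃[ p ] (p ℚ.< q × U p)
    positive : ∃[ p ] (ℚ.0ℚ ℚ.< p × ¬ U p)
    below¼   : U (+ 1 / 4)
open RealIn0¼ public

-- k ≤ α·l  (k, l naturals):  k/l ≤ q for every rational q > α,
-- written without division as  k·den(q) ≤ num(q)·l.
_≤_·_ : ℕ → RealIn0¼ → ℕ → Set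
k ≤ α · l = ∀ q → U α q → (+ k) ℤ.* (↧ q) ℤ.≤ (↥ q) ℤ.* (+ l)

-- n ≤ 2^(4k/(1-4α)):  equivalently n ≤ 2^(4k/(1-4q)) for every rational
-- q with α < q < 1/4 (the bound is continuous and increasing in α).
-- For q = a/b (a ≥ 0, b > 4a) the inequality n ≤ 2^(4kb/(b-4a)) is
-- written in integer form as n^(b-4a) ≤ 2^(4kb).
BoundedBy2^4k/1-4α : ℕ → ℕ → RealIn0¼ → Set
BoundedBy2^4k/1-4α n k α =
  ∀ q → U α q → q ℚ.< + 1 / 4 →
    n ^ (↧ₙ q ∸ 4 * ∣ ↥ q ∣) ≤ 2 ^ (4 * k * ↧ₙ q)

{-# OPTIONS --safe #-}

-- Take N = 2^e with e = ⌊4kl/(l - 4k)⌋ and a random graph on N vertices with edge probability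
-- p = c/D, where D is least with 4N²c^(l-1) ≤ D^(l-1); then the expected number of K_l is below 1/2.
-- By a Chernoff bound (the mean of 2^(#non-edges)) and a union bound, some such graph has no K_l
-- and at least (h + 1)m²/D edges between any two disjoint sets of m = D(2e + 2) vertices, where h/c
-- is a constant just above 1/2.  Hence every set S with at least 2(h + 1)m elements has a vertex with
-- at least h|S|/D neighbours in S, and the Erdős–Szekeres neighbourhood chase, passing to the
-- majority colour at most 2k times, finds a monochromatic K_k.  The bound for a real α follows from
-- k/l ≤ q for every rational q > α, and the minimal number of vertices is found by exhaustive search.
module Submission where

open import Defs
open import Data.Bool as Bool using (Bool; true; false; not; if_then_else_)
open import Data.Bool.Properties using (¬-not)
open import Data.Fin as Fin using (Fin; zero; suc)
open import Data.Fin.Properties using (suc-injective; any?; all?)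
open import Data.Fin.Subset as Subset using (Subset; _∩_; ∁; ∣_∣)
open import Data.Fin.Subset.Properties using (x∈p∩q⁻; ∩-comm; ∣⊥∣≡0; ∣⊤∣≡n; ∉⊥; x∈∁p⇒x∉p; anySubset?)
open import Data.Integer as ℤ using () renaming (+_ to pos)
import Data.Integer.Properties as ℤ
import Data.Integer.Tactic.RingSolver as ℤ
open import Data.List using (List; []; _∷_; _++_; map; length; replicate; cartesianProductWith; cartesianProduct)
open import Data.List.Membership.Propositional using (_∈_)
open import Data.List.Membership.Propositional.Properties using (∈-++⁺ˡ; ∈-++⁺ʳ; ∈-++⁻; ∈-map⁺; ∈-map⁻)
open import Data.List.Properties using (length-replicate; length-++; length-map)
open import Data.List.Relation.Unary.Any using (here; there)
open import Data.Nat
open import Data.Nat.DivMod using (m/n*n≤m; m%n<n; m≡m%n+[m/n]*n)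
open import Data.Nat.Properties hiding (suc-injective)
open import Algebra.Properties.CommutativeSemigroup *-commutativeSemigroup using (x∙yz≈y∙xz) renaming (interchange to *-interchange)
open import Algebra.Properties.CommutativeSemigroup +-commutativeSemigroup using () renaming (interchange to +-interchange)
open import Data.Nat.Tactic.RingSolver using (solve-∀)
open import Data.Product using (Σ; ∃; ∃-syntax; _×_; _,_; proj₁; proj₂)
open import Data.Rational as ℚ using (↥_; ↧_; ↧ₙ_)
import Data.Rational.Properties as ℚ
open import Data.Sum using (_⊎_; inj₁; inj₂)
open import Data.Unit using (⊤; tt)
open import Data.Vec using (Vec; []; _∷_; lookup; here; there; tabulate; _[_]≔_)
open import Data.Vec.Properties using ([]=⇒lookup; lookup⇒[]=; lookup∘tabulate; lookup-map)
open import Function using (_∘_)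
open import Function.Definitions using (Injective)
open import Relation.Binary.PropositionalEquality
open import Relation.Nullary using (Dec; yes; no; ¬_; contradiction)
open import Relation.Nullary.Decidable using (map′; ¬?; _×-dec_; _→-dec_; decidable-stable)
open import Relation.Unary using (Decidable)

-- One step of the chase keeps a fraction of about p/4 of the current set: p/2 for the guaranteed
-- degree, and another half for the majority colour. Since p is about N^(-2/l), after 2k steps about
-- N · 4^(-2k) · N^(-4k/l) vertices remain, and this is about 1 precisely when N = 2^(4k/(1 -
-- 4k/l)). The main terms therefore cancel, and nothing in them pays for the size 2(h + 1)m below
-- which the degree bound fails. That size must be kept linear in k, and the surplus of h/c over 1/2
-- must pay for it. Linearity holds because D is bounded independently of k and l: a rational with
-- denominator B strictly between α and 1/4 forces l/(l - 4k) ≤ B, so that N^(2/l) stays bounded.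
-- The surplus yields an exponential gain (1 + 1/a)^(2k). The Chernoff estimate limits it from
-- above: its elementary form requires (h + 2)/c ≤ log₂(3/2), about 0.585, while the gain requires
-- 2h > c + 1. The choice h = 35, c = 64 satisfies both.

private variable
  X Y Z : Set
  n : ℕ

-- Finite sums over lists and averaging

∑ : List X → (X → ℕ) → ℕ
∑ []       f = 0
∑ (x ∷ xs) f = f x + ∑ xs f

∑-cong : ∀ {f g : X → ℕ} xs → (∀ x → f x ≡ g x) → ∑ xs f ≡ ∑ xs g
∑-cong []       f≡g = refl
∑-cong (x ∷ xs) f≡g = cong₂ _+_ (f≡g x) (∑-cong xs f≡g)

∑-+ : ∀ (f g : X → ℕ) xs → ∑ xs (λ x → f x + g x) ≡ ∑ xs f + ∑ xs g
∑-+ f g []       = refl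
∑-+ f g (x ∷ xs) = trans (cong (f x + g x +_) (∑-+ f g xs)) (+-interchange (f x) (g x) (∑ xs f) (∑ xs g))

∑-*ˡ : ∀ k (f : X → ℕ) xs → ∑ xs (λ x → k * f x) ≡ k * ∑ xs f
∑-*ˡ k f []       = sym (*-zeroʳ k)
∑-*ˡ k f (x ∷ xs) = trans (cong (k * f x +_) (∑-*ˡ k f xs)) (sym (*-distribˡ-+ k (f x) (∑ xs f)))

∑-*ʳ : ∀ k (f : X → ℕ) xs → ∑ xs (λ x → f x * k) ≡ ∑ xs f * k
∑-*ʳ k f xs = trans (∑-cong xs λ x → *-comm (f x) k) (trans (∑-*ˡ k f xs) (*-comm k (∑ xs f)))

∑-constant : ∀ k (xs : List X) → ∑ xs (λ _ → k) ≡ length xs * k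
∑-constant k []       = refl
∑-constant k (x ∷ xs) = cong (k +_) (∑-constant k xs)

∑-swap : ∀ (f : X → Y → ℕ) xs ys →
         ∑ xs (λ x → ∑ ys (f x)) ≡ ∑ ys (λ y → ∑ xs (λ x → f x y))
∑-swap f []       ys = sym (trans (∑-constant 0 ys) (*-zeroʳ (length ys)))
∑-swap f (x ∷ xs) ys =
  trans (cong (∑ ys (f x) +_) (∑-swap f xs ys)) (sym (∑-+ (f x) (λ y → ∑ xs λ x → f x y) ys))

∑-++ : ∀ (f : X → ℕ) xs ys → ∑ (xs ++ ys) f ≡ ∑ xs f + ∑ ys f
∑-++ f []       ys = refl
∑-++ f (x ∷ xs) ys = trans (cong (f x +_) (∑-++ f xs ys)) (sym (+-assoc (f x) _ _))

∑-map : ∀ (f : Y → ℕ) (g : X → Y) xs → ∑ (map g xs) f ≡ ∑ xs (f ∘ g)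
∑-map f g []       = refl
∑-map f g (x ∷ xs) = cong (f (g x) +_) (∑-map f g xs)

∑-cartesianProductWith : ∀ (f : Z → ℕ) (g : X → Y → Z) xs ys →
  ∑ (cartesianProductWith g xs ys) f ≡ ∑ xs (λ x → ∑ ys (λ y → f (g x y)))
∑-cartesianProductWith f g []       ys = refl
∑-cartesianProductWith f g (x ∷ xs) ys =
  trans (∑-++ f (map (g x) ys) _) (cong₂ _+_ (∑-map f (g x) ys) (∑-cartesianProductWith f g xs ys))

∑-replicate : ∀ (f : X → ℕ) k x → ∑ (replicate k x) f ≡ k * f x
∑-replicate f zero    x = refl
∑-replicate f (suc k) x = cong (f x +_) (∑-replicate f k x)

term≤∑ : ∀ (f : X → ℕ) {x xs} → x ∈ xs → f x ≤ ∑ xs f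
term≤∑ f (here refl) = m≤m+n _ _
term≤∑ f (there x∈)  = ≤-trans (term≤∑ f x∈) (m≤n+m _ _)

-- The first-moment principle: this is the one place where a bound on a mean is turned into an
-- actual graph.
∑<length*⇒∃< : ∀ t (f : X → ℕ) xs → ∑ xs f < length xs * t → ∃[ x ] f x < t
∑<length*⇒∃< t f (x ∷ xs) lt with f x <? t
... | yes fx<t = x , fx<t
... | no  fx≮t = ∑<length*⇒∃< t f xs
  (+-cancelˡ-< t _ _ (≤-<-trans (+-monoˡ-≤ (∑ xs f) (≮⇒≥ fx≮t)) lt))

∑≤length* : ∀ t (f : X → ℕ) xs → (∀ {x} → x ∈ xs → f x ≤ t) → ∑ xs f ≤ length xs * t
∑≤length* t f []       f≤t = z≤n
∑≤length* t f (x ∷ xs) f≤t = +-mono-≤ (f≤t (here refl)) (∑≤length* t f xs (f≤t ∘ there))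

-- Enumeration of vectors and of subsets of a given size

vectors : List X → ∀ n → List (Vec X n)
vectors xs zero    = [] ∷ []
vectors xs (suc n) = cartesianProductWith _∷_ xs (vectors xs n)

length-cartesianProductWith : ∀ (g : X → Y → Z) xs ys →
  length (cartesianProductWith g xs ys) ≡ length xs * length ys
length-cartesianProductWith g []       ys = refl
length-cartesianProductWith g (x ∷ xs) ys =
  trans (length-++ (map (g x) ys)) (cong₂ _+_ (length-map (g x) ys) (length-cartesianProductWith g xs ys))

length-vectors : ∀ (xs : List X) n → length (vectors xs n) ≡ length xs ^ n
length-vectors xs zero    = refl
length-vectors xs (suc n) =
  trans (length-cartesianProductWith _∷_ xs (vectors xs n)) (cong (length xs *_) (length-vectors xs n))

subsets : ∀ n → ℕ → List (Subset n)
subsets zero    zero    = [] ∷ []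
subsets zero    (suc s) = []
subsets (suc n) zero    = map (false ∷_) (subsets n zero)
subsets (suc n) (suc s) = map (true ∷_) (subsets n s) ++ map (false ∷_) (subsets n (suc s))

∈-subsets⁺ : ∀ (S : Subset n) → S ∈ subsets n ∣ S ∣
∈-subsets⁺ []          = here refl
∈-subsets⁺ (true  ∷ S) = ∈-++⁺ˡ (∈-map⁺ (true ∷_) (∈-subsets⁺ S))
∈-subsets⁺ (false ∷ S) with ∣ S ∣ | ∈-subsets⁺ S
... | zero  | S∈ = ∈-map⁺ (false ∷_) S∈
... | suc s | S∈ = ∈-++⁺ʳ (map (true ∷_) (subsets _ s)) (∈-map⁺ (false ∷_) S∈)

∈-subsets⁻ : ∀ n s {S : Subset n} → S ∈ subsets n s → ∣ S ∣ ≡ s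
∈-subsets⁻ zero    zero    (here refl) = refl
∈-subsets⁻ (suc n) zero    S∈ with ∈-map⁻ (false ∷_) S∈
... | T , T∈ , refl = ∈-subsets⁻ n zero T∈
∈-subsets⁻ (suc n) (suc s) S∈ with ∈-++⁻ (map (true ∷_) (subsets n s)) S∈
... | inj₁ S∈₁ with ∈-map⁻ (true ∷_) S∈₁
...   | T , T∈ , refl = cong suc (∈-subsets⁻ n s T∈)
∈-subsets⁻ (suc n) (suc s) S∈ | inj₂ S∈₂ with ∈-map⁻ (false ∷_) S∈₂
...   | T , T∈ , refl = ∈-subsets⁻ n (suc s) T∈

-- Pascal's rule, since n^s + n^(s+1) = (n + 1) n^s. This crude bound on the binomial coefficient is
-- good enough for both union bounds.
length-subsets : ∀ n s → length (subsets n s) ≤ n ^ s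
length-subsets zero    zero    = ≤-refl
length-subsets zero    (suc s) = z≤n
length-subsets (suc n) zero    =
  ≤-trans (≤-reflexive (length-map (false ∷_) (subsets n zero))) (length-subsets n zero)
length-subsets (suc n) (suc s) = begin
  length (subsets (suc n) (suc s))
    ≡⟨ length-++ (map (true ∷_) (subsets n s)) ⟩
  length (map (true ∷_) (subsets n s)) + length (map (false ∷_) (subsets n (suc s)))
    ≡⟨ cong₂ _+_ (length-map (true ∷_) (subsets n s)) (length-map (false ∷_) (subsets n (suc s))) ⟩
  length (subsets n s) + length (subsets n (suc s))
    ≤⟨ +-mono-≤ (length-subsets n s) (length-subsets n (suc s)) ⟩
  suc n * n ^ s
    ≤⟨ *-monoʳ-≤ (suc n) (^-monoˡ-≤ s (n≤1+n n)) ⟩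
  suc n ^ suc s ∎
  where open ≤-Reasoning

-- Random graphs and the means of multiplicative weights

-- A graph on n vertices: the adjacencies of the first vertex to the later ones, then the rest.
UpperTriangle : ℕ → Set
UpperTriangle zero    = ⊤
UpperTriangle (suc n) = Vec Bool n × UpperTriangle n

neighbours : UpperTriangle n → Fin n → Subset n
neighbours (r , G) zero    = false ∷ r
neighbours (r , G) (suc u) = lookup r u ∷ neighbours G u

upperTriangles : List Bool → ∀ n → List (UpperTriangle n)
upperTriangles coins zero    = tt ∷ []
upperTriangles coins (suc n) = cartesianProduct (vectors coins n) (upperTriangles coins n)

rowWeight : (Bool → ℕ) → Vec Bool n → Subset n → ℕ
rowWeight w []      []          = 1
rowWeight w (b ∷ r) (true  ∷ S) = w b * rowWeight w r S
rowWeight w (b ∷ r) (false ∷ S) = rowWeight w r S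

cliqueWeight : (Bool → ℕ) → UpperTriangle n → Subset n → ℕ
cliqueWeight w G       []          = 1
cliqueWeight w (r , G) (true  ∷ S) = rowWeight w r S * cliqueWeight w G S
cliqueWeight w (r , G) (false ∷ S) = cliqueWeight w G S

-- Overlapping S and T get weight 0, so that the bound on the sum over all graphs needs no disjointness.
crossWeight : (Bool → ℕ) → UpperTriangle n → Subset n → Subset n → ℕ
crossWeight w G       []          []          = 1
crossWeight w (r , G) (true  ∷ S) (true  ∷ T) = 0
crossWeight w (r , G) (true  ∷ S) (false ∷ T) = rowWeight w r T * crossWeight w G S T
crossWeight w (r , G) (false ∷ S) (true  ∷ T) = rowWeight w r S * crossWeight w G S T
crossWeight w (r , G) (false ∷ S) (false ∷ T) = crossWeight w G S T

-- The binomial coefficient of `s` over 2; the recursion follows `cliqueWeight`, where the first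
-- chosen vertex contributes its row.
pairs : ℕ → ℕ
pairs zero    = 0
pairs (suc s) = s + pairs s

-- The mean weight of a single pair is y/D; the bounds below are cleared of this denominator.
module Expectation (coins : List Bool) (w : Bool → ℕ) where

  D y : ℕ
  D = length coins
  y = ∑ coins w

  rows : ∀ n → List (Vec Bool n)
  rows = vectors coins

  graphs : ∀ n → List (UpperTriangle n)
  graphs = upperTriangles coins

  ∑-graphs-product : ∀ (f : Vec Bool n → ℕ) (g : UpperTriangle n → ℕ) →
    ∑ (graphs (suc n)) (λ (r , G) → f r * g G) ≡ ∑ (rows n) f * ∑ (graphs n) g
  ∑-graphs-product {n} f g = begin
    ∑ (graphs (suc n)) (λ (r , G) → f r * g G)
      ≡⟨ ∑-cartesianProductWith _ _,_ (rows n) (graphs n) ⟩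
    ∑ (rows n) (λ r → ∑ (graphs n) (λ G → f r * g G))
      ≡⟨ ∑-cong (rows n) (λ r → ∑-*ˡ (f r) g (graphs n)) ⟩
    ∑ (rows n) (λ r → f r * ∑ (graphs n) g)
      ≡⟨ ∑-*ʳ (∑ (graphs n) g) f (rows n) ⟩
    ∑ (rows n) f * ∑ (graphs n) g ∎
    where open ≡-Reasoning

  length-graphs : ∀ n → length (graphs (suc n)) ≡ D ^ n * length (graphs n)
  length-graphs n = trans (length-cartesianProductWith _,_ (rows n) (graphs n))
    (cong (_* length (graphs n)) (length-vectors coins n))

  ∑-graphs-rest : ∀ (g : UpperTriangle n → ℕ) →
    ∑ (graphs (suc n)) (λ (r , G) → g G) ≡ D ^ n * ∑ (graphs n) g
  ∑-graphs-rest {n} g = begin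
    ∑ (graphs (suc n)) (λ (r , G) → g G)
      ≡⟨ ∑-cartesianProductWith _ _,_ (rows n) (graphs n) ⟩
    ∑ (rows n) (λ r → ∑ (graphs n) g)
      ≡⟨ ∑-constant (∑ (graphs n) g) (rows n) ⟩
    length (rows n) * ∑ (graphs n) g
      ≡⟨ cong (_* ∑ (graphs n) g) (length-vectors coins n) ⟩
    D ^ n * ∑ (graphs n) g ∎
    where open ≡-Reasoning

  -- The entries of a row are independent: each coordinate in `S` contributes a factor `y` to the
  -- sum, each other coordinate a factor `D`.
  ∑-rowWeight : ∀ (S : Subset n) →
    D ^ ∣ S ∣ * ∑ (rows n) (λ r → rowWeight w r S) ≡ y ^ ∣ S ∣ * D ^ n
  ∑-rowWeight {zero} [] = refl
  ∑-rowWeight {suc n} (true ∷ S) = begin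
    D * D ^ ∣ S ∣ * ∑ (rows (suc n)) (λ r → rowWeight w r (true ∷ S))
      ≡⟨ cong (D * D ^ ∣ S ∣ *_) (∑-cartesianProductWith _ _∷_ coins (rows n)) ⟩
    D * D ^ ∣ S ∣ * ∑ coins (λ b → ∑ (rows n) (λ r → w b * rowWeight w r S))
      ≡⟨ cong (D * D ^ ∣ S ∣ *_) (∑-cong coins (λ b → ∑-*ˡ (w b) _ (rows n))) ⟩
    D * D ^ ∣ S ∣ * ∑ coins (λ b → w b * R)
      ≡⟨ cong (D * D ^ ∣ S ∣ *_) (∑-*ʳ R w coins) ⟩
    D * D ^ ∣ S ∣ * (y * R)
      ≡⟨ regroup D (D ^ ∣ S ∣) y R ⟩
    y * D * (D ^ ∣ S ∣ * R)
      ≡⟨ cong (y * D *_) (∑-rowWeight S) ⟩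
    y * D * (y ^ ∣ S ∣ * D ^ n)
      ≡⟨ *-interchange y D (y ^ ∣ S ∣) (D ^ n) ⟩
    y * y ^ ∣ S ∣ * (D * D ^ n) ∎
    where
    open ≡-Reasoning
    R = ∑ (rows n) (λ r → rowWeight w r S)
    regroup : ∀ a b c d → a * b * (c * d) ≡ c * a * (b * d)
    regroup = solve-∀
  ∑-rowWeight {suc n} (false ∷ S) = begin
    D ^ ∣ S ∣ * ∑ (rows (suc n)) (λ r → rowWeight w r (false ∷ S))
      ≡⟨ cong (D ^ ∣ S ∣ *_) (∑-cartesianProductWith _ _∷_ coins (rows n)) ⟩
    D ^ ∣ S ∣ * ∑ coins (λ b → R)
      ≡⟨ cong (D ^ ∣ S ∣ *_) (∑-constant R coins) ⟩
    D ^ ∣ S ∣ * (D * R)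
      ≡⟨ x∙yz≈y∙xz (D ^ ∣ S ∣) D R ⟩
    D * (D ^ ∣ S ∣ * R)
      ≡⟨ cong (D *_) (∑-rowWeight S) ⟩
    D * (y ^ ∣ S ∣ * D ^ n)
      ≡⟨ x∙yz≈y∙xz D (y ^ ∣ S ∣) (D ^ n) ⟩
    y ^ ∣ S ∣ * (D * D ^ n) ∎
    where
    open ≡-Reasoning
    R = ∑ (rows n) (λ r → rowWeight w r S)

  -- The row of the new vertex is independent of the remaining graph, so the two means multiply. The
  -- hypothesis is an inequality because the mean of `crossWeight` drops to 0 for overlapping sets.
  ∑-extend : ∀ (S : Subset n) (g : UpperTriangle n → ℕ) p →
    D ^ p * ∑ (graphs n) g ≤ y ^ p * length (graphs n) →
    D ^ (∣ S ∣ + p) * ∑ (graphs (suc n)) (λ (r , G) → rowWeight w r S * g G)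
      ≤ y ^ (∣ S ∣ + p) * length (graphs (suc n))
  ∑-extend {n} S g p hyp = begin
    D ^ (∣ S ∣ + p) * ∑ (graphs (suc n)) (λ (r , G) → rowWeight w r S * g G)
      ≡⟨ cong₂ _*_ (^-distribˡ-+-* D ∣ S ∣ p) (∑-graphs-product (λ r → rowWeight w r S) g) ⟩
    D ^ ∣ S ∣ * D ^ p * (∑ (rows n) (λ r → rowWeight w r S) * ∑ (graphs n) g)
      ≡⟨ *-interchange (D ^ ∣ S ∣) (D ^ p) _ _ ⟩
    D ^ ∣ S ∣ * ∑ (rows n) (λ r → rowWeight w r S) * (D ^ p * ∑ (graphs n) g)
      ≤⟨ *-mono-≤ (≤-reflexive (∑-rowWeight S)) hyp ⟩
    y ^ ∣ S ∣ * D ^ n * (y ^ p * length (graphs n))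
      ≡⟨ *-interchange (y ^ ∣ S ∣) (D ^ n) (y ^ p) _ ⟩
    y ^ ∣ S ∣ * y ^ p * (D ^ n * length (graphs n))
      ≡⟨ cong₂ _*_ (^-distribˡ-+-* y ∣ S ∣ p) (length-graphs n) ⟨
    y ^ (∣ S ∣ + p) * length (graphs (suc n)) ∎
    where open ≤-Reasoning

  ∑-skip : ∀ (g : UpperTriangle n → ℕ) p →
    D ^ p * ∑ (graphs n) g ≤ y ^ p * length (graphs n) →
    D ^ p * ∑ (graphs (suc n)) (λ (r , G) → g G) ≤ y ^ p * length (graphs (suc n))
  ∑-skip {n} g p hyp = begin
    D ^ p * ∑ (graphs (suc n)) (λ (r , G) → g G) ≡⟨ cong (D ^ p *_) (∑-graphs-rest g) ⟩
    D ^ p * (D ^ n * ∑ (graphs n) g)             ≡⟨ x∙yz≈y∙xz (D ^ p) (D ^ n) _ ⟩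
    D ^ n * (D ^ p * ∑ (graphs n) g)             ≤⟨ *-monoʳ-≤ (D ^ n) hyp ⟩
    D ^ n * (y ^ p * length (graphs n))          ≡⟨ x∙yz≈y∙xz (D ^ n) (y ^ p) _ ⟩
    y ^ p * (D ^ n * length (graphs n))          ≡⟨ cong (y ^ p *_) (length-graphs n) ⟨
    y ^ p * length (graphs (suc n)) ∎
    where open ≤-Reasoning

  ∑-cliqueWeight : ∀ (S : Subset n) →
    D ^ pairs ∣ S ∣ * ∑ (graphs n) (λ G → cliqueWeight w G S) ≤ y ^ pairs ∣ S ∣ * length (graphs n)
  ∑-cliqueWeight []          = ≤-refl
  ∑-cliqueWeight (true  ∷ S) = ∑-extend S (λ G → cliqueWeight w G S) _ (∑-cliqueWeight S)
  ∑-cliqueWeight (false ∷ S) = ∑-skip (λ G → cliqueWeight w G S) (pairs ∣ S ∣) (∑-cliqueWeight S)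

  ∑-crossWeight : ∀ (S T : Subset n) →
    D ^ (∣ S ∣ * ∣ T ∣) * ∑ (graphs n) (λ G → crossWeight w G S T)
      ≤ y ^ (∣ S ∣ * ∣ T ∣) * length (graphs n)
  ∑-crossWeight [] [] = ≤-refl
  ∑-crossWeight {suc n} (true ∷ S) (true ∷ T) = begin
    D ^ (suc ∣ S ∣ * suc ∣ T ∣) * ∑ (graphs (suc n)) (λ _ → 0)
      ≡⟨ cong (D ^ (suc ∣ S ∣ * suc ∣ T ∣) *_) (trans (∑-constant 0 (graphs (suc n))) (*-zeroʳ (length (graphs (suc n))))) ⟩
    D ^ (suc ∣ S ∣ * suc ∣ T ∣) * 0
      ≡⟨ *-zeroʳ (D ^ (suc ∣ S ∣ * suc ∣ T ∣)) ⟩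
    0
      ≤⟨ z≤n ⟩
    y ^ (suc ∣ S ∣ * suc ∣ T ∣) * length (graphs (suc n)) ∎
    where open ≤-Reasoning
  ∑-crossWeight (true  ∷ S) (false ∷ T) = ∑-extend T (λ G → crossWeight w G S T) _ (∑-crossWeight S T)
  ∑-crossWeight (false ∷ S) (true  ∷ T) rewrite *-suc ∣ S ∣ ∣ T ∣ =
    ∑-extend S (λ G → crossWeight w G S T) _ (∑-crossWeight S T)
  ∑-crossWeight (false ∷ S) (false ∷ T) = ∑-skip (λ G → crossWeight w G S T) (∣ S ∣ * ∣ T ∣) (∑-crossWeight S T)

-- A good graph by the first-moment method

length-upperTriangles≢0 : ∀ coins .{{_ : NonZero (length coins)}} n →
                          NonZero (length (upperTriangles coins n))
length-upperTriangles≢0 coins zero    = _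
length-upperTriangles≢0 coins (suc n) rewrite Expectation.length-graphs coins (λ _ → 0) n =
  m*n≢0 _ _ {{m^n≢0 (length coins) n}} {{length-upperTriangles≢0 coins n}}

-- As weights, these yield the indicator of a clique and 2^(number of non-edges).
edge nonEdge : Bool → ℕ
edge    b = if b then 1 else 0
nonEdge b = if b then 1 else 2

module RandomGraph (c d : ℕ) .{{_ : NonZero c}} where

  -- A uniformly chosen entry is an edge with probability c/(c + d), so a biased random graph is a
  -- uniform member of a list with repetitions.
  coins : List Bool
  coins = replicate c true ++ replicate d false

  length-coins : length coins ≡ c + d
  length-coins = trans (length-++ (replicate c true)) (cong₂ _+_ (length-replicate c) (length-replicate d))

  ∑-coins : ∀ f → ∑ coins f ≡ c * f true + d * f false
  ∑-coins f = trans (∑-++ f (replicate c true) _) (cong₂ _+_ (∑-replicate f c true) (∑-replicate f d false))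

  private instance
    c+d≢0 : NonZero (c + d)
    c+d≢0 = >-nonZero (<-≤-trans (>-nonZero⁻¹ c) (m≤m+n c d))
    coins≢0 : NonZero (length coins)
    coins≢0 = subst NonZero (sym length-coins) c+d≢0

  module _ (n l m t : ℕ) where

    graphs : List (UpperTriangle n)
    graphs = upperTriangles coins n

    cliques crosses : UpperTriangle n → ℕ
    cliques G = ∑ (subsets n l) (cliqueWeight edge G)
    crosses G = ∑ (subsets n m) (λ A → ∑ (subsets n m) (crossWeight nonEdge G A))

    ∑-cliques : 2 * (n ^ l * c ^ pairs l) ≤ (c + d) ^ pairs l → 2 * ∑ graphs cliques ≤ length graphs
    ∑-cliques few = *-cancelˡ-≤ (D ^ pairs l) {{m^n≢0 D (pairs l)}} (begin
      D ^ pairs l * (2 * ∑ graphs cliques)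
        ≡⟨ x∙yz≈y∙xz (D ^ pairs l) 2 _ ⟩
      2 * (D ^ pairs l * ∑ graphs cliques)
        ≡⟨ cong (λ z → 2 * (D ^ pairs l * z)) (∑-swap (λ G S → cliqueWeight edge G S) graphs (subsets n l)) ⟩
      2 * (D ^ pairs l * ∑ (subsets n l) (λ S → ∑ graphs (λ G → cliqueWeight edge G S)))
        ≡⟨ cong (2 *_) (∑-*ˡ (D ^ pairs l) _ (subsets n l)) ⟨
      2 * ∑ (subsets n l) (λ S → D ^ pairs l * ∑ graphs (λ G → cliqueWeight edge G S))
        ≤⟨ *-monoʳ-≤ 2 (∑≤length* (c ^ pairs l * length graphs) _ (subsets n l) bound) ⟩
      2 * (length (subsets n l) * (c ^ pairs l * length graphs))
        ≤⟨ *-monoʳ-≤ 2 (*-monoˡ-≤ (c ^ pairs l * length graphs) (length-subsets n l)) ⟩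
      2 * (n ^ l * (c ^ pairs l * length graphs))
        ≡⟨ regroup′ 2 (n ^ l) (c ^ pairs l) (length graphs) ⟩
      2 * (n ^ l * c ^ pairs l) * length graphs
        ≤⟨ *-monoˡ-≤ (length graphs) few ⟩
      (c + d) ^ pairs l * length graphs
        ≡⟨ cong (λ z → z ^ pairs l * length graphs) length-coins ⟨
      D ^ pairs l * length graphs ∎)
      where
      open ≤-Reasoning
      open Expectation coins edge using (D; y; ∑-cliqueWeight)
      y≡c : y ≡ c
      y≡c = trans (∑-coins edge) (simplify c d)
        where
        simplify : ∀ c d → c * 1 + d * 0 ≡ c
        simplify = solve-∀
      regroup′ : ∀ a b c d → a * (b * (c * d)) ≡ a * (b * c) * d
      regroup′ = solve-∀
      bound : ∀ {S} → S ∈ subsets n l →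
              D ^ pairs l * ∑ graphs (λ G → cliqueWeight edge G S) ≤ c ^ pairs l * length graphs
      bound {S} S∈ with refl ← ∈-subsets⁻ n l S∈ =
        subst (λ z → D ^ pairs ∣ S ∣ * ∑ graphs (λ G → cliqueWeight edge G S) ≤ z ^ pairs ∣ S ∣ * length graphs) y≡c (∑-cliqueWeight S)

    ∑-crosses : 4 * (n ^ m * n ^ m * (c + 2 * d) ^ (m * m)) ≤ 2 ^ t * (c + d) ^ (m * m) →
                4 * ∑ graphs crosses ≤ 2 ^ t * length graphs
    ∑-crosses few = *-cancelˡ-≤ (D ^ (m * m)) {{m^n≢0 D (m * m)}} (begin
      D ^ (m * m) * (4 * ∑ graphs crosses)
        ≡⟨ x∙yz≈y∙xz (D ^ (m * m)) 4 _ ⟩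
      4 * (D ^ (m * m) * ∑ graphs crosses)
        ≡⟨ cong (λ z → 4 * (D ^ (m * m) * z)) swap ⟩
      4 * (D ^ (m * m) * ∑ (subsets n m) (λ A → ∑ (subsets n m) (λ B → E A B)))
        ≡⟨ cong (4 *_) (∑-*ˡ (D ^ (m * m)) _ (subsets n m)) ⟨
      4 * ∑ (subsets n m) (λ A → D ^ (m * m) * ∑ (subsets n m) (E A))
        ≡⟨ cong (4 *_) (∑-cong (subsets n m) (λ A → ∑-*ˡ (D ^ (m * m)) (E A) (subsets n m))) ⟨
      4 * ∑ (subsets n m) (λ A → ∑ (subsets n m) (λ B → D ^ (m * m) * E A B))
        ≤⟨ *-monoʳ-≤ 4 (∑≤length* _ _ (subsets n m) (λ A∈ → ∑≤length* (x * length graphs) _ (subsets n m) (bound A∈))) ⟩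
      4 * (length (subsets n m) * (length (subsets n m) * (x * length graphs)))
        ≤⟨ *-monoʳ-≤ 4 (*-mono-≤ (length-subsets n m) (*-monoˡ-≤ (x * length graphs) (length-subsets n m))) ⟩
      4 * (n ^ m * (n ^ m * (x * length graphs)))
        ≡⟨ regroup′ 4 (n ^ m) (n ^ m) x (length graphs) ⟩
      4 * (n ^ m * n ^ m * x) * length graphs
        ≤⟨ *-monoˡ-≤ (length graphs) few ⟩
      2 ^ t * (c + d) ^ (m * m) * length graphs
        ≡⟨ cong (λ z → 2 ^ t * z ^ (m * m) * length graphs) length-coins ⟨
      2 ^ t * D ^ (m * m) * length graphs
        ≡⟨ regroup″ (2 ^ t) (D ^ (m * m)) (length graphs) ⟩
      D ^ (m * m) * (2 ^ t * length graphs) ∎)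
      where
      open ≤-Reasoning
      open Expectation coins nonEdge using (D; y; ∑-crossWeight)
      x : ℕ
      x = (c + 2 * d) ^ (m * m)
      E : Subset n → Subset n → ℕ
      E A B = ∑ graphs (λ G → crossWeight nonEdge G A B)
      swap : ∑ graphs crosses ≡ ∑ (subsets n m) (λ A → ∑ (subsets n m) (E A))
      swap = trans (∑-swap (λ G A → ∑ (subsets n m) (crossWeight nonEdge G A)) graphs (subsets n m))
        (∑-cong (subsets n m) λ A → ∑-swap (λ G B → crossWeight nonEdge G A B) graphs (subsets n m))
      y≡c+2d : y ≡ c + 2 * d
      y≡c+2d = trans (∑-coins nonEdge) (simplify c d)
        where
        simplify : ∀ c d → c * 1 + d * 2 ≡ c + 2 * d
        simplify = solve-∀
      regroup′ : ∀ a b c d e → a * (b * (c * (d * e))) ≡ a * (b * c * d) * e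
      regroup′ = solve-∀
      regroup″ : ∀ a b c → a * b * c ≡ b * (a * c)
      regroup″ = solve-∀
      bound : ∀ {A} → A ∈ subsets n m → ∀ {B} → B ∈ subsets n m → D ^ (m * m) * E A B ≤ x * length graphs
      bound {A} A∈ {B} B∈ = subst₂ (λ z p → D ^ p * E A B ≤ z ^ p * length graphs) y≡c+2d
        (cong₂ _*_ (∈-subsets⁻ n m A∈) (∈-subsets⁻ n m B∈)) (∑-crossWeight A B)

    -- Both demands are merged into the single potential `Φ`, whose mean is at most (1/2 + 1/4) ·
    -- 2^t. In a graph with `Φ` below 2^t no clique can occur, as one alone costs 2^t, and no pair
    -- of sets can have cross weight 2^t or more.
    ∃-graph : 2 * (n ^ l * c ^ pairs l) ≤ (c + d) ^ pairs l →
              4 * (n ^ m * n ^ m * (c + 2 * d) ^ (m * m)) ≤ 2 ^ t * (c + d) ^ (m * m) →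
              Σ (UpperTriangle n) λ G → (∀ S → ∣ S ∣ ≡ l → cliqueWeight edge G S ≡ 0)
                   × (∀ A B → ∣ A ∣ ≡ m → ∣ B ∣ ≡ m → crossWeight nonEdge G A B < 2 ^ t)
    ∃-graph fewCliques fewCrosses =
      let G , Φ<2^t = ∑<length*⇒∃< (2 ^ t) Φ graphs total
      in  G , noClique G Φ<2^t , noCross G Φ<2^t
      where
      open ≤-Reasoning
      Φ : UpperTriangle n → ℕ
      Φ G = 2 ^ t * cliques G + crosses G

      distribute : ∀ a x y → 4 * (a * x + y) ≡ 2 * a * (2 * x) + 4 * y
      distribute = solve-∀
      collect : ∀ a k → 2 * a * k + a * k ≡ 3 * (k * a)
      collect = solve-∀

      total : ∑ graphs Φ < length graphs * 2 ^ t
      total = *-cancelˡ-< 4 _ _ (begin-strict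
        4 * ∑ graphs Φ
          ≡⟨ cong (4 *_) (trans (∑-+ (λ G → 2 ^ t * cliques G) crosses graphs)
                                (cong (_+ ∑ graphs crosses) (∑-*ˡ (2 ^ t) cliques graphs))) ⟩
        4 * (2 ^ t * ∑ graphs cliques + ∑ graphs crosses)
          ≡⟨ distribute (2 ^ t) (∑ graphs cliques) (∑ graphs crosses) ⟩
        2 * 2 ^ t * (2 * ∑ graphs cliques) + 4 * ∑ graphs crosses
          ≤⟨ +-mono-≤ (*-monoʳ-≤ (2 * 2 ^ t) (∑-cliques fewCliques)) (∑-crosses fewCrosses) ⟩
        2 * 2 ^ t * length graphs + 2 ^ t * length graphs
          ≡⟨ collect (2 ^ t) (length graphs) ⟩
        3 * (length graphs * 2 ^ t)
          <⟨ *-monoˡ-< (length graphs * 2 ^ t)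
               {{m*n≢0 _ _ {{length-upperTriangles≢0 coins n}} {{m^n≢0 2 t}}}} (n<1+n 3) ⟩
        4 * (length graphs * 2 ^ t) ∎)

      noClique : ∀ G → Φ G < 2 ^ t → ∀ S → ∣ S ∣ ≡ l → cliqueWeight edge G S ≡ 0
      noClique G Φ<2^t S refl = n<1⇒n≡0 (*-cancelˡ-< (2 ^ t) _ _ (begin-strict
        2 ^ t * cliqueWeight edge G S
          ≤⟨ *-monoʳ-≤ (2 ^ t) (term≤∑ (cliqueWeight edge G) (∈-subsets⁺ S)) ⟩
        2 ^ t * cliques G ≤⟨ m≤m+n _ _ ⟩
        Φ G               <⟨ Φ<2^t ⟩
        2 ^ t             ≡⟨ *-identityʳ _ ⟨
        2 ^ t * 1 ∎))

      noCross : ∀ G → Φ G < 2 ^ t → ∀ A B → ∣ A ∣ ≡ m → ∣ B ∣ ≡ m → crossWeight nonEdge G A B < 2 ^ t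
      noCross G Φ<2^t A B refl |B|≡m = begin-strict
        crossWeight nonEdge G A B
          ≤⟨ term≤∑ (crossWeight nonEdge G A) (subst (λ s → B ∈ subsets n s) |B|≡m (∈-subsets⁺ B)) ⟩
        ∑ (subsets n m) (crossWeight nonEdge G A)
          ≤⟨ term≤∑ (λ A → ∑ (subsets n m) (crossWeight nonEdge G A)) (∈-subsets⁺ A) ⟩
        crosses G ≤⟨ m≤n+m _ _ ⟩
        Φ G       <⟨ Φ<2^t ⟩
        2 ^ t ∎

-- Edge counts between vertex sets

∑∈ : Subset n → (Fin n → ℕ) → ℕ
∑∈ []          f = 0
∑∈ (true  ∷ S) f = f zero + ∑∈ S (f ∘ suc)
∑∈ (false ∷ S) f = ∑∈ S (f ∘ suc)

∑∈-cong : ∀ {f g : Fin n → ℕ} (S : Subset n) → (∀ u → f u ≡ g u) → ∑∈ S f ≡ ∑∈ S g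
∑∈-cong []          f≡g = refl
∑∈-cong (true  ∷ S) f≡g = cong₂ _+_ (f≡g zero) (∑∈-cong S (f≡g ∘ suc))
∑∈-cong (false ∷ S) f≡g = ∑∈-cong S (f≡g ∘ suc)

∑∈-+ : ∀ (f g : Fin n → ℕ) (S : Subset n) → ∑∈ S (λ u → f u + g u) ≡ ∑∈ S f + ∑∈ S g
∑∈-+ f g []          = refl
∑∈-+ f g (true  ∷ S) =
  trans (cong (f zero + g zero +_) (∑∈-+ (f ∘ suc) (g ∘ suc) S)) (+-interchange (f zero) (g zero) _ _)
∑∈-+ f g (false ∷ S) = ∑∈-+ (f ∘ suc) (g ∘ suc) S

∑∈-*ˡ : ∀ k (f : Fin n → ℕ) (S : Subset n) → ∑∈ S (λ u → k * f u) ≡ k * ∑∈ S f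
∑∈-*ˡ k f []          = sym (*-zeroʳ k)
∑∈-*ˡ k f (true  ∷ S) =
  trans (cong (k * f zero +_) (∑∈-*ˡ k (f ∘ suc) S)) (sym (*-distribˡ-+ k (f zero) _))
∑∈-*ˡ k f (false ∷ S) = ∑∈-*ˡ k (f ∘ suc) S

∑∈-constant : ∀ k (S : Subset n) → ∑∈ S (λ _ → k) ≡ ∣ S ∣ * k
∑∈-constant k []          = refl
∑∈-constant k (true  ∷ S) = cong (k +_) (∑∈-constant k S)
∑∈-constant k (false ∷ S) = ∑∈-constant k S

∑∈>∣S∣*⇒∃> : ∀ k (f : Fin n → ℕ) (S : Subset n) → ∣ S ∣ * k < ∑∈ S f → ∃[ u ] u Subset.∈ S × k < f u
∑∈>∣S∣*⇒∃> k f (true ∷ S) lt with k <? f zero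
... | yes k<f = zero , here , k<f
... | no  k≮f =
  let u , u∈S , k<fu = ∑∈>∣S∣*⇒∃> k (f ∘ suc) S (+-cancelˡ-< k _ _ (<-≤-trans lt (+-monoˡ-≤ _ (≮⇒≥ k≮f))))
  in  suc u , there u∈S , k<fu
∑∈>∣S∣*⇒∃> k f (false ∷ S) lt =
  let u , u∈S , k<fu = ∑∈>∣S∣*⇒∃> k (f ∘ suc) S lt
  in  suc u , there u∈S , k<fu

toℕ : Bool → ℕ
toℕ b = if b then 1 else 0

∣∷∣ : ∀ b (S : Subset n) → ∣ b ∷ S ∣ ≡ toℕ b + ∣ S ∣
∣∷∣ true  S = refl
∣∷∣ false S = refl

∣∩∣+∣∩∁∣ : ∀ (S T : Subset n) → ∣ S ∩ T ∣ + ∣ S ∩ ∁ T ∣ ≡ ∣ S ∣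
∣∩∣+∣∩∁∣ []          []          = refl
∣∩∣+∣∩∁∣ (false ∷ S) (_     ∷ T) = ∣∩∣+∣∩∁∣ S T
∣∩∣+∣∩∁∣ (true  ∷ S) (true  ∷ T) = cong suc (∣∩∣+∣∩∁∣ S T)
∣∩∣+∣∩∁∣ (true  ∷ S) (false ∷ T) = trans (+-suc _ _) (cong suc (∣∩∣+∣∩∁∣ S T))

∑∈-toℕ : ∀ (S T : Subset n) → ∑∈ S (toℕ ∘ lookup T) ≡ ∣ S ∩ T ∣
∑∈-toℕ []          []          = refl
∑∈-toℕ (true  ∷ S) (true  ∷ T) = cong suc (∑∈-toℕ S T)
∑∈-toℕ (true  ∷ S) (false ∷ T) = ∑∈-toℕ S T
∑∈-toℕ (false ∷ S) (_     ∷ T) = ∑∈-toℕ S T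

-- Disjoint union, recorded coordinate by coordinate so that the counting lemmas are inductions on
-- the derivation.
data _≐_⊍_ : Subset n → Subset n → Subset n → Set where
  []      : [] ≐ [] ⊍ []
  neither : ∀ {S T V : Subset n} → S ≐ T ⊍ V → (false ∷ S) ≐ (false ∷ T) ⊍ (false ∷ V)
  left    : ∀ {S T V : Subset n} → S ≐ T ⊍ V → (true  ∷ S) ≐ (true  ∷ T) ⊍ (false ∷ V)
  right   : ∀ {S T V : Subset n} → S ≐ T ⊍ V → (true  ∷ S) ≐ (false ∷ T) ⊍ (true  ∷ V)

∣⊍∣ : ∀ {S T V : Subset n} → S ≐ T ⊍ V → ∣ S ∣ ≡ ∣ T ∣ + ∣ V ∣
∣⊍∣ []          = refl
∣⊍∣ (neither p) = ∣⊍∣ p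
∣⊍∣ (left p)    = cong suc (∣⊍∣ p)
∣⊍∣ (right p)   = trans (cong suc (∣⊍∣ p)) (sym (+-suc _ _))

∣⊍∩∣ : ∀ {S T V : Subset n} → S ≐ T ⊍ V → ∀ X → ∣ S ∩ X ∣ ≡ ∣ T ∩ X ∣ + ∣ V ∩ X ∣
∣⊍∩∣ []          []          = refl
∣⊍∩∣ (neither p) (_     ∷ X) = ∣⊍∩∣ p X
∣⊍∩∣ (left p)    (true  ∷ X) = cong suc (∣⊍∩∣ p X)
∣⊍∩∣ (left p)    (false ∷ X) = ∣⊍∩∣ p X
∣⊍∩∣ (right p)   (true  ∷ X) = trans (cong suc (∣⊍∩∣ p X)) (sym (+-suc _ _))
∣⊍∩∣ (right p)   (false ∷ X) = ∣⊍∩∣ p X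

⊍-disjoint : ∀ {S T V : Subset n} → S ≐ T ⊍ V → ∣ T ∩ V ∣ ≡ 0
⊍-disjoint []          = refl
⊍-disjoint (neither p) = ⊍-disjoint p
⊍-disjoint (left p)    = ⊍-disjoint p
⊍-disjoint (right p)   = ⊍-disjoint p

⊍-⊆ˡ : ∀ {S T V : Subset n} → S ≐ T ⊍ V → T Subset.⊆ S
⊍-⊆ˡ (left p)    here       = here
⊍-⊆ˡ (neither p) (there x∈) = there (⊍-⊆ˡ p x∈)
⊍-⊆ˡ (left p)    (there x∈) = there (⊍-⊆ˡ p x∈)
⊍-⊆ˡ (right p)   (there x∈) = there (⊍-⊆ˡ p x∈)

split : ∀ m (S : Subset n) → m ≤ ∣ S ∣ → ∃[ T ] ∃[ V ] (S ≐ T ⊍ V × ∣ T ∣ ≡ m)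
split zero    []          m≤ = [] , [] , [] , refl
split m       (false ∷ S) m≤ =
  let T , V , p , |T| = split m S m≤ in false ∷ T , false ∷ V , neither p , |T|
split zero    (true ∷ S)  m≤ =
  let T , V , p , |T| = split zero S z≤n in false ∷ T , true ∷ V , right p , |T|
split (suc m) (true ∷ S)  (s≤s m≤) =
  let T , V , p , |T| = split m S m≤ in true ∷ T , false ∷ V , left p , cong suc |T|

∣∩∣-comm : ∀ (S T : Subset n) → ∣ S ∩ T ∣ ≡ ∣ T ∩ S ∣
∣∩∣-comm S T = cong ∣_∣ (∩-comm S T)

module _ (G : UpperTriangle n) where
  edgesBetween nonEdgesBetween : Subset n → Subset n → ℕ
  edgesBetween    A B = ∑∈ A (λ u → ∣ B ∩ neighbours G u ∣)
  nonEdgesBetween A B = ∑∈ A (λ u → ∣ B ∩ ∁ (neighbours G u) ∣)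

  edges+nonEdges : ∀ A B → edgesBetween A B + nonEdgesBetween A B ≡ ∣ A ∣ * ∣ B ∣
  edges+nonEdges A B = begin
    edgesBetween A B + nonEdgesBetween A B
      ≡⟨ ∑∈-+ _ _ A ⟨
    ∑∈ A (λ u → ∣ B ∩ neighbours G u ∣ + ∣ B ∩ ∁ (neighbours G u) ∣)
      ≡⟨ ∑∈-cong A (λ u → ∣∩∣+∣∩∁∣ B (neighbours G u)) ⟩
    ∑∈ A (λ _ → ∣ B ∣)
      ≡⟨ ∑∈-constant ∣ B ∣ A ⟩
    ∣ A ∣ * ∣ B ∣ ∎
    where open ≡-Reasoning

rowWeight-nonEdge : ∀ (r : Vec Bool n) S → rowWeight nonEdge r S ≡ 2 ^ ∣ S ∩ ∁ r ∣
rowWeight-nonEdge []          []          = refl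
rowWeight-nonEdge (true  ∷ r) (true  ∷ S) = trans (*-identityˡ _) (rowWeight-nonEdge r S)
rowWeight-nonEdge (false ∷ r) (true  ∷ S) = cong (2 *_) (rowWeight-nonEdge r S)
rowWeight-nonEdge (_     ∷ r) (false ∷ S) = rowWeight-nonEdge r S

-- `crossWeight` charges a pair to its smaller vertex, `nonEdgesBetween` to its vertex in `A`. The
-- two agree directly when the first vertex lies in `A`; when it lies in `B`, its row is
-- redistributed over the members of `A`.
crossWeight-nonEdge : ∀ (G : UpperTriangle n) A B → ∣ A ∩ B ∣ ≡ 0 →
                      crossWeight nonEdge G A B ≡ 2 ^ nonEdgesBetween G A B
crossWeight-nonEdge _       []          []          _ = refl
crossWeight-nonEdge (r , G) (true  ∷ A) (false ∷ B) disjoint =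
  trans (cong₂ _*_ (rowWeight-nonEdge r B) (crossWeight-nonEdge G A B disjoint))
        (sym (^-distribˡ-+-* 2 ∣ B ∩ ∁ r ∣ (nonEdgesBetween G A B)))
crossWeight-nonEdge (r , G) (false ∷ A) (true  ∷ B) disjoint = begin
  rowWeight nonEdge r A * crossWeight nonEdge G A B
    ≡⟨ cong₂ _*_ (rowWeight-nonEdge r A) (crossWeight-nonEdge G A B disjoint) ⟩
  2 ^ ∣ A ∩ ∁ r ∣ * 2 ^ nonEdgesBetween G A B
    ≡⟨ ^-distribˡ-+-* 2 ∣ A ∩ ∁ r ∣ (nonEdgesBetween G A B) ⟨
  2 ^ (∣ A ∩ ∁ r ∣ + nonEdgesBetween G A B)
    ≡⟨ cong (λ z → 2 ^ (z + nonEdgesBetween G A B)) (∑∈-toℕ A (∁ r)) ⟨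
  2 ^ (∑∈ A (toℕ ∘ lookup (∁ r)) + nonEdgesBetween G A B)
    ≡⟨ cong (2 ^_) (∑∈-+ _ _ A) ⟨
  2 ^ ∑∈ A (λ u → toℕ (lookup (∁ r) u) + ∣ B ∩ ∁ (neighbours G u) ∣)
    ≡⟨ cong (2 ^_) (∑∈-cong A (λ u → trans (cong (λ z → toℕ z + ∣ B ∩ ∁ (neighbours G u) ∣) (lookup-map u not r))
         (sym (∣∷∣ (not (lookup r u)) (B ∩ ∁ (neighbours G u)))))) ⟩
  2 ^ ∑∈ A (λ u → ∣ not (lookup r u) ∷ (B ∩ ∁ (neighbours G u)) ∣) ∎
  where open ≡-Reasoning
crossWeight-nonEdge (r , G) (false ∷ A) (false ∷ B) disjoint = crossWeight-nonEdge G A B disjoint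

-- Vertices of high degree inside large sets

HighDegree : ℕ → ℕ → ℕ → UpperTriangle n → Set
HighDegree D h s G =
  ∀ S → s ≤ ∣ S ∣ → ∃[ v ] (v Subset.∈ S × h * ∣ S ∣ ≤ D * ∣ S ∩ neighbours G v ∣)

module _ (G : UpperTriangle n) (D h m : ℕ) .{{_ : NonZero m}}
         (dense : ∀ A B → ∣ A ∣ ≡ m → ∣ B ∣ ≡ m → ∣ A ∩ B ∣ ≡ 0 → h * (m * m) ≤ D * edgesBetween G A B)
  where

  -- B is exhausted by disjoint m-element subsets; the last summand pays for the remainder.
  dense-large : ∀ size A B → ∣ B ∣ ≤ size → ∣ A ∣ ≡ m → ∣ A ∩ B ∣ ≡ 0 →
                h * (m * ∣ B ∣) ≤ D * edgesBetween G A B + h * (m * m)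
  dense-large size A B |B|≤size |A|≡m disjoint with m ≤? ∣ B ∣
  ... | no m≰|B| = begin
    h * (m * ∣ B ∣)                         ≤⟨ *-monoʳ-≤ h (*-monoʳ-≤ m (<⇒≤ (≰⇒> m≰|B|))) ⟩
    h * (m * m)                             ≤⟨ m≤n+m _ _ ⟩
    D * edgesBetween G A B + h * (m * m)    ∎
    where open ≤-Reasoning
  dense-large zero A B |B|≤size |A|≡m disjoint | yes m≤|B| =
    contradiction (≤-trans m≤|B| |B|≤size) (<⇒≱ (>-nonZero⁻¹ m))
  dense-large (suc size) A B |B|≤size |A|≡m disjoint | yes m≤|B| with split m B m≤|B|
  ... | B₁ , B₂ , B≐B₁⊍B₂ , |B₁|≡m = begin
    h * (m * ∣ B ∣)
      ≡⟨ cong (λ z → h * (m * z)) (trans (∣⊍∣ B≐B₁⊍B₂) (cong (_+ ∣ B₂ ∣) |B₁|≡m)) ⟩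
    h * (m * (m + ∣ B₂ ∣))
      ≡⟨ distribute h m ∣ B₂ ∣ ⟩
    h * (m * m) + h * (m * ∣ B₂ ∣)
      ≤⟨ +-mono-≤ (dense A B₁ |A|≡m |B₁|≡m disjoint₁) (dense-large size A B₂ |B₂|≤size |A|≡m disjoint₂) ⟩
    D * edgesBetween G A B₁ + (D * edgesBetween G A B₂ + h * (m * m))
      ≡⟨ collect D (edgesBetween G A B₁) (edgesBetween G A B₂) (h * (m * m)) ⟩
    D * (edgesBetween G A B₁ + edgesBetween G A B₂) + h * (m * m)
      ≡⟨ cong (λ z → D * z + h * (m * m)) (trans (sym (∑∈-+ _ _ A))
           (∑∈-cong A (λ u → sym (∣⊍∩∣ B≐B₁⊍B₂ (neighbours G u))))) ⟩
    D * edgesBetween G A B + h * (m * m) ∎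
    where
    open ≤-Reasoning
    distribute : ∀ h m b → h * (m * (m + b)) ≡ h * (m * m) + h * (m * b)
    distribute = solve-∀
    collect : ∀ D x y z → D * x + (D * y + z) ≡ D * (x + y) + z
    collect = solve-∀
    both : ∣ A ∩ B₁ ∣ + ∣ A ∩ B₂ ∣ ≡ 0
    both = trans (cong₂ _+_ (∣∩∣-comm A B₁) (∣∩∣-comm A B₂))
             (trans (sym (∣⊍∩∣ B≐B₁⊍B₂ A)) (trans (∣∩∣-comm B A) disjoint))
    disjoint₁ = m+n≡0⇒m≡0 ∣ A ∩ B₁ ∣ both
    disjoint₂ = m+n≡0⇒n≡0 ∣ A ∩ B₁ ∣ both
    |B₂|≤size : ∣ B₂ ∣ ≤ size
    |B₂|≤size = s≤s⁻¹ (≤-trans (+-monoˡ-≤ ∣ B₂ ∣ (>-nonZero⁻¹ m))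
      (≤-trans (≤-reflexive (trans (cong (_+ ∣ B₂ ∣) (sym |B₁|≡m)) (sym (∣⊍∣ B≐B₁⊍B₂)))) |B|≤size))

  someVertex : ∀ A B → ∣ A ∣ ≡ m → ∣ A ∩ B ∣ ≡ 0 →
               ∃[ u ] (u Subset.∈ A × h * ∣ B ∣ ≤ D * ∣ B ∩ neighbours G u ∣ + h * m)
  someVertex A B |A|≡m disjoint =
    -- The summand 1 makes the inequality of totals strict, as the pigeonhole lemma demands; `s≤s⁻¹`
    -- removes it again.
    let u , u∈A , lt = ∑∈>∣S∣*⇒∃> (h * ∣ B ∣) (λ u → 1 + (D * ∣ B ∩ neighbours G u ∣ + h * m)) A total
    in  u , u∈A , s≤s⁻¹ lt
    where
    open ≤-Reasoning
    total : ∣ A ∣ * (h * ∣ B ∣) < ∑∈ A (λ u → 1 + (D * ∣ B ∩ neighbours G u ∣ + h * m))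
    total = begin-strict
      ∣ A ∣ * (h * ∣ B ∣)
        ≡⟨ cong (_* (h * ∣ B ∣)) |A|≡m ⟩
      m * (h * ∣ B ∣)
        ≡⟨ x∙yz≈y∙xz m h ∣ B ∣ ⟩
      h * (m * ∣ B ∣)
        ≤⟨ dense-large ∣ B ∣ A B ≤-refl |A|≡m disjoint ⟩
      D * edgesBetween G A B + h * (m * m)
        <⟨ m<n+m _ (>-nonZero⁻¹ m) ⟩
      m + (D * edgesBetween G A B + h * (m * m))
        ≡⟨ cong₂ _+_ (trans (sym |A|≡m) (trans (sym (*-identityʳ _)) (sym (∑∈-constant 1 A))))
             (cong₂ _+_ (sym (∑∈-*ˡ D _ A)) (trans (x∙yz≈y∙xz h m m) (trans (cong (_* (h * m)) (sym |A|≡m)) (sym (∑∈-constant (h * m) A))))) ⟩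
      ∑∈ A (λ _ → 1) + (∑∈ A (λ u → D * ∣ B ∩ neighbours G u ∣) + ∑∈ A (λ _ → h * m))
        ≡⟨ cong (∑∈ A (λ _ → 1) +_) (∑∈-+ _ _ A) ⟨
      ∑∈ A (λ _ → 1) + ∑∈ A (λ u → D * ∣ B ∩ neighbours G u ∣ + h * m)
        ≡⟨ ∑∈-+ _ _ A ⟨
      ∑∈ A (λ u → 1 + (D * ∣ B ∩ neighbours G u ∣ + h * m)) ∎

-- The vertex is sought in an `m`-subset `A` of `S`, with degree counted into the rest. Discarding
-- `A` costs (h + 1)m, and `someVertex` loses the same amount again. Lowering the coefficient from h
-- + 1 to h frees |S|, which covers both losses by the assumed size of `S`.
highDegree : ∀ (G : UpperTriangle n) D h m .{{_ : NonZero m}} →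
  (∀ A B → ∣ A ∣ ≡ m → ∣ B ∣ ≡ m → ∣ A ∩ B ∣ ≡ 0 → suc h * (m * m) ≤ D * edgesBetween G A B) →
  HighDegree D h (2 * suc h * m) G
highDegree G D h m dense S large with split m S (≤-trans (m≤n*m m (2 * suc h)) large)
... | A , B , S≐A⊍B , |A|≡m with someVertex G D (suc h) m dense A B |A|≡m (⊍-disjoint S≐A⊍B)
...   | u , u∈A , deg = u , ⊍-⊆ˡ S≐A⊍B u∈A , +-cancelʳ-≤ ∣ S ∣ _ _ (begin
  h * ∣ S ∣ + ∣ S ∣
    ≡⟨ +-comm (h * ∣ S ∣) ∣ S ∣ ⟩
  suc h * ∣ S ∣
    ≡⟨ cong (suc h *_) (trans (∣⊍∣ S≐A⊍B) (cong (_+ ∣ B ∣) |A|≡m)) ⟩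
  suc h * (m + ∣ B ∣)
    ≡⟨ *-distribˡ-+ (suc h) m ∣ B ∣ ⟩
  suc h * m + suc h * ∣ B ∣
    ≤⟨ +-monoʳ-≤ (suc h * m) deg ⟩
  suc h * m + (D * ∣ B ∩ neighbours G u ∣ + suc h * m)
    ≡⟨ collect (suc h) m (D * ∣ B ∩ neighbours G u ∣) ⟩
  D * ∣ B ∩ neighbours G u ∣ + 2 * suc h * m
    ≤⟨ +-mono-≤ (*-monoʳ-≤ D (≤-trans (m≤n+m _ _) (≤-reflexive (sym (∣⊍∩∣ S≐A⊍B (neighbours G u)))))) large ⟩
  D * ∣ S ∩ neighbours G u ∣ + ∣ S ∣ ∎)
  where
  open ≤-Reasoning
  collect : ∀ a m x → a * m + (x + a * m) ≡ x + 2 * a * m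
  collect = solve-∀

-- The associated graph and its freedom from large cliques

neighbours-symm : ∀ (G : UpperTriangle n) u v → lookup (neighbours G u) v ≡ lookup (neighbours G v) u
neighbours-symm (r , G) zero    zero    = refl
neighbours-symm (r , G) zero    (suc v) = refl
neighbours-symm (r , G) (suc u) zero    = refl
neighbours-symm (r , G) (suc u) (suc v) = neighbours-symm G u v

neighbours-irrefl : ∀ (G : UpperTriangle n) v → lookup (neighbours G v) v ≡ false
neighbours-irrefl (r , G) zero    = refl
neighbours-irrefl (r , G) (suc v) = neighbours-irrefl G v

toGraph : UpperTriangle n → Graph n
toGraph G = record
  { adj    = λ u → lookup (neighbours G u)
  ; symm   = neighbours-symm G
  ; irrefl = neighbours-irrefl G
  }

rowWeight-edge : ∀ (r : Vec Bool n) S → (∀ {v} → v Subset.∈ S → lookup r v ≡ true) → rowWeight edge r S ≡ 1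
rowWeight-edge []      []          all = refl
rowWeight-edge (b ∷ r) (true  ∷ S) all =
  cong₂ _*_ (cong edge (all here)) (rowWeight-edge r S (all ∘ there))
rowWeight-edge (b ∷ r) (false ∷ S) all = rowWeight-edge r S (all ∘ there)

cliqueWeight-edge : ∀ (G : UpperTriangle n) S →
  (∀ {u v} → u Subset.∈ S → v Subset.∈ S → u ≢ v → lookup (neighbours G u) v ≡ true) →
  cliqueWeight edge G S ≡ 1
cliqueWeight-edge G       []          clique = refl
cliqueWeight-edge (r , G) (true  ∷ S) clique =
  cong₂ _*_ (rowWeight-edge r S (λ v∈S → clique here (there v∈S) λ ()))
            (cliqueWeight-edge G S (λ u∈S v∈S u≢v → clique (there u∈S) (there v∈S) (u≢v ∘ suc-injective)))
cliqueWeight-edge (r , G) (false ∷ S) clique =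
  cliqueWeight-edge G S (λ u∈S v∈S u≢v → clique (there u∈S) (there v∈S) (u≢v ∘ suc-injective))

∈-insert⁻ : ∀ (S : Subset n) x {v} → v Subset.∈ (S [ x ]≔ true) → v ≡ x ⊎ v Subset.∈ S
∈-insert⁻ (b ∷ S) zero    here       = inj₁ refl
∈-insert⁻ (b ∷ S) zero    (there v∈) = inj₂ (there v∈)
∈-insert⁻ (b ∷ S) (suc x) here       = inj₂ here
∈-insert⁻ (b ∷ S) (suc x) (there v∈) with ∈-insert⁻ S x v∈
... | inj₁ refl = inj₁ refl
... | inj₂ v∈S  = inj₂ (there v∈S)

∣insert∣ : ∀ (S : Subset n) x → x Subset.∉ S → ∣ S [ x ]≔ true ∣ ≡ suc ∣ S ∣
∣insert∣ (true  ∷ S) zero    x∉S = contradiction here x∉S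
∣insert∣ (false ∷ S) zero    x∉S = refl
∣insert∣ (true  ∷ S) (suc x) x∉S = cong suc (∣insert∣ S x (x∉S ∘ there))
∣insert∣ (false ∷ S) (suc x) x∉S = ∣insert∣ S x (x∉S ∘ there)

image : ∀ {l} → (Fin l → Fin n) → Subset n
image {l = zero}  f = Subset.⊥
image {l = suc l} f = image (f ∘ suc) [ f zero ]≔ true

∈-image⁻ : ∀ {l} (f : Fin l → Fin n) {v} → v Subset.∈ image f → ∃[ i ] f i ≡ v
∈-image⁻ {l = zero}  f v∈ = contradiction v∈ ∉⊥
∈-image⁻ {l = suc l} f v∈ with ∈-insert⁻ (image (f ∘ suc)) (f zero) v∈
... | inj₁ refl = zero , refl
... | inj₂ v∈′  with ∈-image⁻ (f ∘ suc) v∈′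
...   | i , fi≡v = suc i , fi≡v

∣image∣ : ∀ {l} (f : Fin l → Fin n) → Injective _≡_ _≡_ f → ∣ image f ∣ ≡ l
∣image∣ {n} {zero} f f-inj = ∣⊥∣≡0 n
∣image∣ {n} {suc l} f f-inj =
  trans (∣insert∣ (image (f ∘ suc)) (f zero) f0∉) (cong suc (∣image∣ (f ∘ suc) (suc-injective ∘ f-inj)))
  where
  f0∉ : f zero Subset.∉ image (f ∘ suc)
  f0∉ f0∈ with ∈-image⁻ (f ∘ suc) f0∈
  ... | i , eq with f-inj eq
  ...   | ()

toGraph-K-free : ∀ (G : UpperTriangle n) l → (∀ S → ∣ S ∣ ≡ l → cliqueWeight edge G S ≡ 0) → K-free (toGraph G) l
toGraph-K-free G l noClique K =
  0≢1+n (trans (sym (noClique (image (emb K)) (∣image∣ (emb K) (emb-inj K))))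
               (cliqueWeight-edge G (image (emb K)) clique))
  where
  clique : ∀ {u v} → u Subset.∈ image (emb K) → v Subset.∈ image (emb K) → u ≢ v → lookup (neighbours G u) v ≡ true
  clique u∈ v∈ u≢v with ∈-image⁻ (emb K) u∈ | ∈-image⁻ (emb K) v∈
  ... | i , refl | j , refl = edges K i j (u≢v ∘ cong (emb K))

-- The neighbourhood chase

adjacent⇒injective : ∀ {k} (G : Graph n) (f : Fin k → Fin n) →
  (∀ i j → i ≢ j → adj G (f i) (f j) ≡ true) → Injective _≡_ _≡_ f
adjacent⇒injective G f adjacent {i} {j} fi≡fj with i Fin.≟ j
... | yes i≡j = i≡j
... | no  i≢j with () ← trans (sym (adjacent i j i≢j)) (trans (cong (adj G (f i)) (sym fi≡fj)) (irrefl G (f i)))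

module Chase (G : UpperTriangle n) (c : TwoColouring (toGraph G)) where

  -- Distinct indices receive distinct vertices through `adjacent`, as a graph has no loops;
  -- `toMonoCliqueCopy` recovers injectivity from this. Confinement to `S` is what allows a common
  -- neighbour of `S` to be prepended.
  record MonoCliqueIn (col : Bool) (S : Subset n) (k : ℕ) : Set where
    field
      vertex   : Fin k → Fin n
      vertex∈  : ∀ i → vertex i Subset.∈ S
      adjacent : ∀ i j → i ≢ j → adj (toGraph G) (vertex i) (vertex j) ≡ true
      coloured : ∀ i j → i ≢ j → colour c (vertex i) (vertex j) ≡ col
  open MonoCliqueIn

  empty : ∀ {col S} → MonoCliqueIn col S 0
  empty = record { vertex = λ () ; vertex∈ = λ () ; adjacent = λ () ; coloured = λ () }

  cons : ∀ {col S T k v} → v Subset.∈ S → T Subset.⊆ S →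
         (∀ {x} → x Subset.∈ T → adj (toGraph G) v x ≡ true × colour c v x ≡ col) →
         MonoCliqueIn col T k → MonoCliqueIn col S (suc k)
  cons {v = v} v∈S T⊆S joined K = record
    { vertex   = λ { zero → v ; (suc i) → vertex K i }
    ; vertex∈  = λ { zero → v∈S ; (suc i) → T⊆S (vertex∈ K i) }
    ; adjacent = λ
      { zero    zero    i≢j → contradiction refl i≢j
      ; zero    (suc j) i≢j → proj₁ (joined (vertex∈ K j))
      ; (suc i) zero    i≢j → trans (symm (toGraph G) (vertex K i) v) (proj₁ (joined (vertex∈ K i)))
      ; (suc i) (suc j) i≢j → adjacent K i j (i≢j ∘ cong suc)
      }
    ; coloured = λ
      { zero    zero    i≢j → contradiction refl i≢j
      ; zero    (suc j) i≢j → proj₂ (joined (vertex∈ K j))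
      ; (suc i) zero    i≢j → trans (colour-symm c (vertex K i) v) (proj₂ (joined (vertex∈ K i)))
      ; (suc i) (suc j) i≢j → coloured K i j (i≢j ∘ cong suc)
      }
    }

  toMonoCliqueCopy : ∀ {col S k} → MonoCliqueIn col S k → MonoCliqueCopy (toGraph G) c k
  toMonoCliqueCopy {col} K = record
    { copy = record { emb = vertex K ; emb-inj = adjacent⇒injective (toGraph G) (vertex K) (adjacent K) ; edges = adjacent K }
    ; col  = col
    ; mono = coloured K
    }

  module _ (D h s : ℕ) .{{_ : NonZero h}} (h≤2D : h ≤ 2 * D) (highDegree : HighDegree D h s G) where

    private instance
      2D≢0 : NonZero (2 * D)
      2D≢0 = >-nonZero (<-≤-trans (>-nonZero⁻¹ h) h≤2D)

    -- The hypothesis is the invariant of the chase: after `t` further cuts by the factor h/(2D) at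
    -- least `s` vertices would remain.
    large-enough : ∀ t x → s * (2 * D) ^ t ≤ x * h ^ t → s ≤ x
    large-enough t x large = *-cancelʳ-≤ s x ((2 * D) ^ t) {{m^n≢0 (2 * D) t}}
      (≤-trans large (*-monoʳ-≤ x (^-monoˡ-≤ t h≤2D)))

    shrink : ∀ t {S T U} → h * S ≤ D * T → T ≤ 2 * U →
             s * (2 * D) ^ suc t ≤ S * h ^ suc t → s * (2 * D) ^ t ≤ U * h ^ t
    shrink t {S} {T} {U} hS≤DT T≤2U large = *-cancelˡ-≤ (2 * D) (begin
      2 * D * (s * (2 * D) ^ t) ≡⟨ x∙yz≈y∙xz (2 * D) s _ ⟩
      s * (2 * D) ^ suc t       ≤⟨ large ⟩
      S * h ^ suc t             ≡⟨ regroup′ S h (h ^ t) ⟩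
      h * S * h ^ t             ≤⟨ *-monoˡ-≤ (h ^ t) (≤-trans hS≤DT (*-monoʳ-≤ D T≤2U)) ⟩
      D * (2 * U) * h ^ t       ≡⟨ regroup″ D U (h ^ t) ⟩
      2 * D * (U * h ^ t) ∎)
      where
      open ≤-Reasoning
      regroup′ : ∀ a b c → a * (b * c) ≡ b * a * c
      regroup′ = solve-∀
      regroup″ : ∀ a b c → a * (2 * b) * c ≡ 2 * a * (b * c)
      regroup″ = solve-∀

    -- Each step fixes a vertex `v` and moves to its neighbours in the majority colour, which lowers
    -- `r + b` by one. A clique found there in that colour is extended by `v`; one in the other
    -- colour already has the required size.
    chase : ∀ r b S → s * (2 * D) ^ (r + b) ≤ ∣ S ∣ * h ^ (r + b) →
            MonoCliqueIn true S r ⊎ MonoCliqueIn false S b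
    chase zero    b       S large = inj₁ empty
    chase (suc r) zero    S large = inj₂ empty
    chase (suc r) (suc b) S large with highDegree S (large-enough (suc r + suc b) ∣ S ∣ large)
    ... | v , v∈S , hS≤DT = step (≤-total ∣ Blue ∣ ∣ Red ∣)
      where
      T C Red Blue : Subset n
      T    = S ∩ neighbours G v
      C    = tabulate (colour c v)
      Red  = T ∩ C
      Blue = T ∩ ∁ C

      ∣T∣ : ∣ T ∣ ≡ ∣ Red ∣ + ∣ Blue ∣
      ∣T∣ = sym (∣∩∣+∣∩∁∣ T C)

      double : ∀ x → x + x ≡ 2 * x
      double = solve-∀

      T⊆S : ∀ {X} → T ∩ X Subset.⊆ S
      T⊆S {X} x∈ = proj₁ (x∈p∩q⁻ S (neighbours G v) (proj₁ (x∈p∩q⁻ T X x∈)))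

      adjacent-T : ∀ {X x} → x Subset.∈ T ∩ X → adj (toGraph G) v x ≡ true
      adjacent-T {X} x∈ = []=⇒lookup (proj₂ (x∈p∩q⁻ S (neighbours G v) (proj₁ (x∈p∩q⁻ T X x∈))))

      red : ∀ {x} → x Subset.∈ C → colour c v x ≡ true
      red {x} x∈C = trans (sym (lookup∘tabulate (colour c v) x)) ([]=⇒lookup x∈C)

      blue : ∀ {x} → x Subset.∈ ∁ C → colour c v x ≡ false
      blue {x} x∈∁C = ¬-not λ cx≡true →
        x∈∁p⇒x∉p x∈∁C (lookup⇒[]= x C (trans (lookup∘tabulate (colour c v) x) cx≡true))

      step : ∣ Blue ∣ ≤ ∣ Red ∣ ⊎ ∣ Red ∣ ≤ ∣ Blue ∣ →
             MonoCliqueIn true S (suc r) ⊎ MonoCliqueIn false S (suc b)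
      step (inj₁ Blue≤Red) with chase r (suc b) Red (shrink (r + suc b) {U = ∣ Red ∣} hS≤DT
        (≤-trans (≤-reflexive ∣T∣) (≤-trans (+-monoʳ-≤ ∣ Red ∣ Blue≤Red) (≤-reflexive (double ∣ Red ∣)))) large)
      ... | inj₁ K = inj₁ (cons v∈S T⊆S (λ x∈ → adjacent-T x∈ , red (proj₂ (x∈p∩q⁻ T C x∈))) K)
      ... | inj₂ K = inj₂ (record { MonoCliqueIn K ; vertex∈ = T⊆S ∘ vertex∈ K })
      step (inj₂ Red≤Blue) with chase (suc r) b Blue (shrink (suc r + b) {U = ∣ Blue ∣} hS≤DT
        (≤-trans (≤-reflexive ∣T∣) (≤-trans (+-monoˡ-≤ ∣ Blue ∣ Red≤Blue) (≤-reflexive (double ∣ Blue ∣))))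
        (subst (λ t → s * (2 * D) ^ t ≤ ∣ S ∣ * h ^ t) (+-suc (suc r) b) large))
      ... | inj₁ K = inj₁ (record { MonoCliqueIn K ; vertex∈ = T⊆S ∘ vertex∈ K })
      ... | inj₂ K = inj₂ (cons v∈S T⊆S (λ x∈ → adjacent-T x∈ , blue (proj₂ (x∈p∩q⁻ T (∁ C) x∈))) K)

toGraph-⟶K : ∀ (G : UpperTriangle n) k D h s .{{_ : NonZero h}} → h ≤ 2 * D → HighDegree D h s G →
  s * (2 * D) ^ (k + k) ≤ n * h ^ (k + k) → toGraph G ⟶K k
toGraph-⟶K {n} G k D h s h≤2D highDegree large c
  with Chase.chase G c D h s h≤2D highDegree k k Subset.⊤
         (subst (λ x → s * (2 * D) ^ (k + k) ≤ x * h ^ (k + k)) (sym (∣⊤∣≡n n)) large)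
... | inj₁ K = Chase.toMonoCliqueCopy G c K
... | inj₂ K = Chase.toMonoCliqueCopy G c K

-- Power inequalities and the Chernoff estimate

^-cancelˡ-≤ : ∀ o .{{_ : NonZero o}} {m n} → m ^ o ≤ n ^ o → m ≤ n
^-cancelˡ-≤ o {m} {n} m^o≤n^o with m ≤? n
... | yes m≤n = m≤n
... | no  m≰n = contradiction m^o≤n^o (<⇒≱ (^-monoˡ-< o (≰⇒> m≰n)))

^-distribʳ-* : ∀ m n o → (m * n) ^ o ≡ m ^ o * n ^ o
^-distribʳ-* m n zero    = refl
^-distribʳ-* m n (suc o) = trans (cong (m * n *_) (^-distribʳ-* m n o)) (*-interchange m n (m ^ o) (n ^ o))

^-swap : ∀ m n o → (m ^ n) ^ o ≡ (m ^ o) ^ n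
^-swap m n o = trans (^-*-assoc m n o) (trans (cong (m ^_) (*-comm n o)) (sym (^-*-assoc m o n)))

-- Bernoulli's inequality (1 - 1/y)^c ≥ 1 - c/y for y = z + 1, cleared of denominators.
bernoulli-∸ : ∀ z c → (suc z ∸ c) * suc z ^ c ≤ suc z * z ^ c
bernoulli-∸ z zero    = ≤-refl
bernoulli-∸ z (suc c) = begin
  (z ∸ c) * (suc z * suc z ^ c) ≡⟨ *-assoc (z ∸ c) (suc z) _ ⟨
  (z ∸ c) * suc z * suc z ^ c   ≤⟨ *-monoˡ-≤ (suc z ^ c) shift ⟩
  (suc z ∸ c) * z * suc z ^ c   ≡⟨ regroup (suc z ∸ c) z (suc z ^ c) ⟩
  z * ((suc z ∸ c) * suc z ^ c) ≤⟨ *-monoʳ-≤ z (bernoulli-∸ z c) ⟩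
  z * (suc z * z ^ c)           ≡⟨ x∙yz≈y∙xz z (suc z) (z ^ c) ⟩
  suc z * (z * z ^ c)           ∎
  where
  open ≤-Reasoning
  regroup : ∀ a b c → a * b * c ≡ b * (a * c)
  regroup = solve-∀
  shift : (z ∸ c) * suc z ≤ (suc z ∸ c) * z
  shift with c ≤? z
  ... | no  c≰z rewrite m≤n⇒m∸n≡0 (<⇒≤ (≰⇒> c≰z)) = z≤n
  ... | yes c≤z rewrite +-∸-assoc 1 c≤z = begin
    (z ∸ c) * suc z         ≡⟨ *-suc (z ∸ c) z ⟩
    (z ∸ c) + (z ∸ c) * z   ≤⟨ +-monoˡ-≤ _ (m∸n≤m z c) ⟩
    z + (z ∸ c) * z         ∎

binomial₂ : ∀ z n → z ^ suc n + suc n * z ^ n ≤ suc z ^ suc n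
binomial₂ z zero    = ≤-reflexive (eq z)
  where
  eq : ∀ z → z * 1 + 1 * 1 ≡ (1 + z) * 1
  eq = solve-∀
binomial₂ z (suc n) = begin
  z * (z * z ^ n) + (2 + n) * (z * z ^ n)
    ≤⟨ m≤m+n _ (suc n * z ^ n) ⟩
  z * (z * z ^ n) + (2 + n) * (z * z ^ n) + suc n * z ^ n
    ≡⟨ eq z n (z ^ n) ⟩
  suc z * (z ^ suc n + suc n * z ^ n)
    ≤⟨ *-monoʳ-≤ (suc z) (binomial₂ z n) ⟩
  suc z ^ suc (suc n) ∎
  where
  open ≤-Reasoning
  eq : ∀ z n x → z * (z * x) + (2 + n) * (z * x) + (1 + n) * x ≡ (1 + z) * (z * x + (1 + n) * x)
  eq = solve-∀

-- (1 + 1/z)^(n+1) ≥ 1 + (n + 1)/z ≥ 3/2. For z close to 2(n + 1) this is an integer substitute for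
-- the limit value √e.
3/2-bound : ∀ z n → z ≤ 2 * suc n → 3 * z ^ suc n ≤ 2 * suc z ^ suc n
3/2-bound z n z≤2n = begin
  3 * (z * z ^ n)                         ≡⟨ eq (z * z ^ n) ⟩
  2 * (z * z ^ n) + z * z ^ n             ≤⟨ +-monoʳ-≤ _ (*-monoˡ-≤ (z ^ n) z≤2n) ⟩
  2 * (z * z ^ n) + 2 * suc n * z ^ n     ≡⟨ eq′ (z * z ^ n) (suc n) (z ^ n) ⟩
  2 * (z ^ suc n + suc n * z ^ n)         ≤⟨ *-monoʳ-≤ 2 (binomial₂ z n) ⟩
  2 * suc z ^ suc n                       ∎
  where
  open ≤-Reasoning
  eq : ∀ x → 3 * x ≡ 2 * x + x
  eq = solve-∀
  eq′ : ∀ x a b → 2 * x + 2 * a * b ≡ 2 * (x + a * b)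
  eq′ = solve-∀

-- With p = c/D this reads (1 - p/2)^D ≤ 2^(-h-1): the expectation of 2^(#non-edges), normalised.
chernoff : ∀ c d h → .{{_ : NonZero c}} → 2 ^ (suc h + c) ≤ 3 ^ c →
           2 ^ suc h * (c + 2 * d) ^ (c + d) ≤ (2 * (c + d)) ^ (c + d)
chernoff c@(suc c₀) d h 2^≤3^ = *-cancelˡ-≤ (2 ^ c * y ^ (c * D)) {{m*n≢0 _ _ {{m^n≢0 2 c}} {{m^n≢0 y (c * D)}}}} (begin
  2 ^ c * y ^ (c * D) * (2 ^ suc h * x ^ D)
    ≡⟨ regroup (2 ^ c) (y ^ (c * D)) (2 ^ suc h) (x ^ D) ⟩
  2 ^ suc h * 2 ^ c * (x ^ D * y ^ (c * D))
    ≤⟨ *-mono-≤ (≤-trans (≤-reflexive (sym (^-distribˡ-+-* 2 (suc h) c))) 2^≤3^) first ⟩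
  3 ^ c * (y ^ D * z ^ (c * D))
    ≡⟨ regroup′ (3 ^ c) (y ^ D) (z ^ (c * D)) ⟩
  3 ^ c * z ^ (c * D) * y ^ D
    ≤⟨ *-monoˡ-≤ (y ^ D) second ⟩
  2 ^ c * y ^ (c * D) * y ^ D ∎)
  where
  open ≤-Reasoning
  D x y z : ℕ
  D = c + d
  x = c + 2 * d
  -- Spelled so that `suc z` computes to `2 * (c + d)`.
  z = c₀ + d + 1 * D
  y = suc z
  regroup : ∀ a b c d → a * b * (c * d) ≡ c * a * (d * b)
  regroup = solve-∀
  regroup′ : ∀ a b c → a * (b * c) ≡ a * c * b
  regroup′ = solve-∀
  y∸c : y ∸ c ≡ x
  y∸c = trans (cong (_∸ c) (eq c d)) (m+n∸m≡n c x)
    where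
    eq : ∀ c d → (c + d) + 1 * (c + d) ≡ c + (c + 2 * d)
    eq = solve-∀
  -- For y = 2D Bernoulli's inequality gives x/y = 1 - c/y ≤ (1 - 1/y)^c. Hence (x/y)^D is at most
  -- the `c`-th power of (1 - 1/y)^D, and the latter is at most 2/3 by `3/2-bound`.
  first : x ^ D * y ^ (c * D) ≤ y ^ D * z ^ (c * D)
  first = begin
    x ^ D * y ^ (c * D)   ≡⟨ cong (x ^ D *_) (^-*-assoc y c D) ⟨
    x ^ D * (y ^ c) ^ D   ≡⟨ ^-distribʳ-* x (y ^ c) D ⟨
    (x * y ^ c) ^ D       ≤⟨ ^-monoˡ-≤ D (subst (λ a → a * y ^ c ≤ y * z ^ c) y∸c (bernoulli-∸ z c)) ⟩
    (y * z ^ c) ^ D       ≡⟨ ^-distribʳ-* y (z ^ c) D ⟩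
    y ^ D * (z ^ c) ^ D   ≡⟨ cong (y ^ D *_) (^-*-assoc z c D) ⟩
    y ^ D * z ^ (c * D)   ∎
  second : 3 ^ c * z ^ (c * D) ≤ 2 ^ c * y ^ (c * D)
  second = begin
    3 ^ c * z ^ (c * D)   ≡⟨ cong (3 ^ c *_) (trans (cong (z ^_) (*-comm c D)) (sym (^-*-assoc z D c))) ⟩
    3 ^ c * (z ^ D) ^ c   ≡⟨ ^-distribʳ-* 3 (z ^ D) c ⟨
    (3 * z ^ D) ^ c       ≤⟨ ^-monoˡ-≤ c (3/2-bound z (c₀ + d) (n≤1+n z)) ⟩
    (2 * y ^ D) ^ c       ≡⟨ ^-distribʳ-* 2 (y ^ D) c ⟩
    2 ^ c * (y ^ D) ^ c   ≡⟨ cong (2 ^ c *_) (trans (cong (y ^_) (*-comm c D)) (sym (^-*-assoc y D c))) ⟨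
    2 ^ c * y ^ (c * D)   ∎

-- Union bounds and the graph they provide

-- Here m² = Dq, and `chernoff` raised to the power q bounds the mean weight of one pair of sets by
-- 2^((j-1)q). The spare factor 2^q has to absorb 4N^(2m) = 2^(2+2em). Since q = mw, the choice w =
-- 2e + 2 achieves this.
crosses-bound : ∀ c d h j e → .{{_ : NonZero c}} → 2 ^ (suc h + c) ≤ 3 ^ c → c + d ≡ j + h →
  let w = 2 * e + 2 ; q = (c + d) * (w * w) ; m = (c + d) * w in
  4 * ((2 ^ e) ^ m * (2 ^ e) ^ m * (c + 2 * d) ^ (m * m)) ≤ 2 ^ (j * q) * (c + d) ^ (m * m)
crosses-bound c d h j e 2^≤3^ c+d≡j+h = *-cancelʳ-≤ _ _ (2 ^ (h * q)) {{m^n≢0 2 (h * q)}} (begin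
  4 * ((2 ^ e) ^ m * (2 ^ e) ^ m * x ^ (m * m)) * 2 ^ (h * q)
    ≡⟨ regroup 4 ((2 ^ e) ^ m * (2 ^ e) ^ m) (x ^ (m * m)) (2 ^ (h * q)) ⟩
  4 * ((2 ^ e) ^ m * (2 ^ e) ^ m) * 2 ^ (h * q) * x ^ (m * m)
    ≤⟨ *-monoˡ-≤ (x ^ (m * m)) (*-monoˡ-≤ (2 ^ (h * q)) few) ⟩
  2 ^ q * 2 ^ (h * q) * x ^ (m * m)
    ≡⟨ cong₂ _*_ (trans (sym (^-distribˡ-+-* 2 q (h * q))) (sym (^-*-assoc 2 (suc h) q)))
                 (trans (cong (x ^_) m*m≡D*q) (sym (^-*-assoc x D q))) ⟩
  (2 ^ suc h) ^ q * (x ^ D) ^ q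
    ≡⟨ ^-distribʳ-* (2 ^ suc h) (x ^ D) q ⟨
  (2 ^ suc h * x ^ D) ^ q
    ≤⟨ ^-monoˡ-≤ q (chernoff c d h 2^≤3^) ⟩
  ((2 * D) ^ D) ^ q
    ≡⟨ ^-*-assoc (2 * D) D q ⟩
  (2 * D) ^ (D * q)
    ≡⟨ ^-distribʳ-* 2 D (D * q) ⟩
  2 ^ (D * q) * D ^ (D * q)
    ≡⟨ cong₂ (λ a b → 2 ^ (a * q) * D ^ b) c+d≡j+h (sym m*m≡D*q) ⟩
  2 ^ ((j + h) * q) * D ^ (m * m)
    ≡⟨ cong (_* D ^ (m * m)) (trans (cong (2 ^_) (*-distribʳ-+ q j h)) (^-distribˡ-+-* 2 (j * q) (h * q))) ⟩
  2 ^ (j * q) * 2 ^ (h * q) * D ^ (m * m)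
    ≡⟨ regroup′ (2 ^ (j * q)) (2 ^ (h * q)) (D ^ (m * m)) ⟩
  2 ^ (j * q) * D ^ (m * m) * 2 ^ (h * q) ∎)
  where
  open ≤-Reasoning
  D w q m x : ℕ
  D = c + d
  w = 2 * e + 2
  q = D * (w * w)
  m = D * w
  x = c + 2 * d
  regroup : ∀ a b c d → a * (b * c) * d ≡ a * b * d * c
  regroup = solve-∀
  regroup′ : ∀ a b c → a * b * c ≡ a * c * b
  regroup′ = solve-∀
  m*m≡D*q : m * m ≡ D * q
  m*m≡D*q = eq D w
    where
    eq : ∀ D w → D * w * (D * w) ≡ D * (D * (w * w))
    eq = solve-∀
  m≥1 : 1 ≤ m
  m≥1 = *-mono-≤ (≤-trans (>-nonZero⁻¹ c) (m≤m+n c d)) (≤-trans (n≤1+n 1) (m≤n+m 2 (2 * e)))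
  exponent : 2 + (e * m + e * m) ≤ q
  exponent = begin
    2 + (e * m + e * m)     ≤⟨ +-monoˡ-≤ _ (*-monoʳ-≤ 2 m≥1) ⟩
    2 * m + (e * m + e * m) ≡⟨ eq D e ⟩
    q ∎
    where
    eq : ∀ D e → 2 * (D * (2 * e + 2)) + (e * (D * (2 * e + 2)) + e * (D * (2 * e + 2))) ≡ D * ((2 * e + 2) * (2 * e + 2))
    eq = solve-∀
  few : 4 * ((2 ^ e) ^ m * (2 ^ e) ^ m) ≤ 2 ^ q
  few = begin
    4 * ((2 ^ e) ^ m * (2 ^ e) ^ m)    ≡⟨ cong (4 *_) (cong₂ _*_ (^-*-assoc 2 e m) (^-*-assoc 2 e m)) ⟩
    4 * (2 ^ (e * m) * 2 ^ (e * m))    ≡⟨ cong (4 *_) (^-distribˡ-+-* 2 (e * m) (e * m)) ⟨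
    2 ^ 2 * 2 ^ (e * m + e * m)        ≡⟨ ^-distribˡ-+-* 2 2 (e * m + e * m) ⟨
    2 ^ (2 + (e * m + e * m))          ≤⟨ ^-monoʳ-≤ 2 exponent ⟩
    2 ^ q ∎

pairs+pairs : ∀ s → pairs (suc s) + pairs (suc s) ≡ suc s * s
pairs+pairs zero    = refl
pairs+pairs (suc s) = begin
  suc s + pairs (suc s) + (suc s + pairs (suc s))   ≡⟨ +-interchange (suc s) _ (suc s) _ ⟩
  suc s + suc s + (pairs (suc s) + pairs (suc s))   ≡⟨ cong (suc s + suc s +_) (pairs+pairs s) ⟩
  suc s + suc s + suc s * s                         ≡⟨ eq s ⟩
  suc (suc s) * suc s                               ∎
  where
  open ≡-Reasoning
  eq : ∀ s → (1 + s) + (1 + s) + (1 + s) * s ≡ (2 + s) * (1 + s)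
  eq = solve-∀

-- Squaring turns `pairs (suc l)` into (l + 1)l, and the claim becomes the hypothesis raised to the
-- power l + 1, with 4 ≤ 4^(l+1) to spare.
cliques-bound : ∀ N c D l → 4 * (N * N) * c ^ l ≤ D ^ l →
                2 * (N ^ suc l * c ^ pairs (suc l)) ≤ D ^ pairs (suc l)
cliques-bound N c D l hyp = ^-cancelˡ-≤ 2 (begin
  (2 * (N ^ L * c ^ p)) ^ 2                 ≡⟨ regroup (N ^ L) (c ^ p) ⟩
  4 * (N ^ L * N ^ L * (c ^ p * c ^ p))     ≤⟨ *-monoˡ-≤ (N ^ L * N ^ L * (c ^ p * c ^ p)) (^-monoʳ-≤ 4 {1} {L} (s≤s z≤n)) ⟩
  4 ^ L * (N ^ L * N ^ L * (c ^ p * c ^ p)) ≡⟨ cong₂ (λ a b → 4 ^ L * (a * b)) (sym (^-distribʳ-* N N L)) (square c) ⟩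
  4 ^ L * ((N * N) ^ L * (c ^ l) ^ L)       ≡⟨ *-assoc (4 ^ L) _ _ ⟨
  4 ^ L * (N * N) ^ L * (c ^ l) ^ L         ≡⟨ cong (_* (c ^ l) ^ L) (^-distribʳ-* 4 (N * N) L) ⟨
  (4 * (N * N)) ^ L * (c ^ l) ^ L           ≡⟨ ^-distribʳ-* (4 * (N * N)) (c ^ l) L ⟨
  (4 * (N * N) * c ^ l) ^ L                 ≤⟨ ^-monoˡ-≤ L hyp ⟩
  (D ^ l) ^ L                               ≡⟨ square D ⟨
  D ^ p * D ^ p                             ≡⟨ cong (D ^ p *_) (*-identityʳ _) ⟨
  (D ^ p) ^ 2 ∎)
  where
  open ≤-Reasoning
  L p : ℕ
  L = suc l
  p = pairs L
  regroup : ∀ a b → 2 * (a * b) * (2 * (a * b) * 1) ≡ 4 * (a * a * (b * b))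
  regroup = solve-∀
  square : ∀ x → x ^ p * x ^ p ≡ (x ^ l) ^ L
  square x = trans (sym (^-distribˡ-+-* x p p))
    (trans (cong (x ^_) (trans (pairs+pairs l) (*-comm L l))) (sym (^-*-assoc x l L)))

-- Density is established with coefficient h + 1, because `highDegree` gives up one unit; hence the
-- exponent 2 + h + c rather than 1 + h + c in the Chernoff condition.
folkmanGraph : ∀ c d h k l e → .{{_ : NonZero c}} .{{_ : NonZero h}} →
  2 ^ (2 + h + c) ≤ 3 ^ c → h < c + d →
  4 * (2 ^ e * 2 ^ e) * c ^ l ≤ (c + d) ^ l →
  2 * suc h * ((c + d) * (2 * e + 2)) * (2 * (c + d)) ^ (k + k) ≤ 2 ^ e * h ^ (k + k) →
  FolkmanGraphExists k (suc l) (2 ^ e)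
folkmanGraph c d h k l e 2^≤3^ h<D fewCliques large =
  -- With j = D - (h + 1), at most jq non-edges among the m² = Dq pairs leave (h + 1)q edges.
  let j , h+j≡D = m≤n⇒∃[o]m+o≡n h<D
      D≡j+h     = trans (sym h+j≡D) (+-comm (suc h) j)
      G , noClique , noCross = RandomGraph.∃-graph c d (2 ^ e) (suc l) m (j * q)
        (cliques-bound (2 ^ e) c D l fewCliques) (crosses-bound c d (suc h) j e 2^≤3^ D≡j+h)
  in  toGraph G
    , toGraph-⟶K G k D h (2 * suc h * m) (≤-trans (<⇒≤ h<D) (m≤n*m D 2))
        (highDegree G D h m (dense j D≡j+h G noCross)) large
    , toGraph-K-free G (suc l) noClique
  where
  D w m q : ℕ
  D = c + d
  w = 2 * e + 2
  m = D * w
  q = D * (w * w)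
  instance
    m≢0 : NonZero m
    m≢0 = m*n≢0 D w {{>-nonZero (≤-trans (>-nonZero⁻¹ c) (m≤m+n c d))}} {{>-nonZero (≤-trans (n≤1+n 1) (m≤n+m 2 (2 * e)))}}
  dense : ∀ j → D ≡ j + suc h → ∀ (G : UpperTriangle (2 ^ e)) → (∀ A B → ∣ A ∣ ≡ m → ∣ B ∣ ≡ m → crossWeight nonEdge G A B < 2 ^ (j * q)) →
          ∀ A B → ∣ A ∣ ≡ m → ∣ B ∣ ≡ m → ∣ A ∩ B ∣ ≡ 0 → suc h * (m * m) ≤ D * edgesBetween G A B
  dense j D≡j+h G noCross A B |A|≡m |B|≡m disjoint = begin
    suc h * (m * m)             ≡⟨ eq (suc h) D w ⟩
    D * (suc h * q)             ≤⟨ *-monoʳ-≤ D (+-cancelʳ-≤ (j * q) _ _ count) ⟩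
    D * edgesBetween G A B      ∎
    where
    open ≤-Reasoning
    eq : ∀ h D w → h * (D * w * (D * w)) ≡ D * (h * (D * (w * w)))
    eq = solve-∀
    eq′ : ∀ D w → D * (D * (w * w)) ≡ D * w * (D * w)
    eq′ = solve-∀
    fewNonEdges : nonEdgesBetween G A B ≤ j * q
    fewNonEdges = <⇒≤ (≰⇒> λ jq≤ → <⇒≱ (noCross A B |A|≡m |B|≡m)
      (≤-trans (^-monoʳ-≤ 2 jq≤) (≤-reflexive (sym (crossWeight-nonEdge G A B disjoint)))))
    count : suc h * q + j * q ≤ edgesBetween G A B + j * q
    count = begin
      suc h * q + j * q
        ≡⟨ *-distribʳ-+ q (suc h) j ⟨
      (suc h + j) * q
        ≡⟨ cong (_* q) (trans (+-comm (suc h) j) (sym D≡j+h)) ⟩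
      D * q
        ≡⟨ eq′ D w ⟩
      m * m
        ≡⟨ cong₂ _*_ |A|≡m |B|≡m ⟨
      ∣ A ∣ * ∣ B ∣
        ≡⟨ edges+nonEdges G A B ⟨
      edgesBetween G A B + nonEdgesBetween G A B
        ≤⟨ +-monoʳ-≤ (edgesBetween G A B) fewNonEdges ⟩
      edgesBetween G A B + j * q ∎

-- Choice of D and of the exponent

least : ∀ {P : ℕ → Set} → Decidable P → ∀ n → P n → ∃[ m ] (m ≤ n × P m × (∀ i → i < m → ¬ P i))
least P? n Pn with P? 0
... | yes P0 = 0 , z≤n , P0 , λ _ ()
least P? zero    Pn | no ¬P0 = contradiction Pn ¬P0
least P? (suc n) Pn | no ¬P0 with least (P? ∘ suc) n Pn
... | m , m≤n , Pm , below = suc m , s≤s m≤n , Pm , λ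
  { zero    _         → ¬P0
  ; (suc i) (s≤s i<m) → below i i<m
  }

-- An integer `D` just above c · M^(1/l), obtained without roots. By minimality D - 1 fails the
-- inequality, and D - 1 ≥ c gives cD ≤ (c + 1)(D - 1), so rounding up costs at most the factor (c +
-- 1)/c.
rootApproximation : ∀ c l M .{{_ : NonZero c}} .{{_ : NonZero l}} → 1 < M →
  ∃[ D ] (c < D × M * c ^ l ≤ D ^ l × D ^ l ≤ suc c ^ l * M)
rootApproximation c l@(suc l₀) M 1<M = close (least (λ D → M * c ^ l ≤? D ^ l) (M * c) witness)
  where
  open ≤-Reasoning
  instance
    M≢0 : NonZero M
    M≢0 = >-nonZero (≤-trans (n≤1+n 1) 1<M)
    c^l≢0 : NonZero (c ^ l)
    c^l≢0 = m^n≢0 c l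
  witness : M * c ^ l ≤ (M * c) ^ l
  witness = begin
    M * c ^ l       ≤⟨ *-monoˡ-≤ (c ^ l) (m≤m*n M (M ^ l₀) {{m^n≢0 M l₀}}) ⟩
    M ^ l * c ^ l   ≡⟨ ^-distribʳ-* M c l ⟨
    (M * c) ^ l     ∎
  above : ∀ D → M * c ^ l ≤ D ^ l → c < D
  above D MC≤D^l = ≰⇒> λ D≤c → <⇒≱ (m<m*n (c ^ l) M 1<M)
    (≤-trans (≤-reflexive (*-comm (c ^ l) M)) (≤-trans MC≤D^l (^-monoˡ-≤ l D≤c)))
  close : ∃[ D ] (D ≤ M * c × M * c ^ l ≤ D ^ l × (∀ i → i < D → ¬ M * c ^ l ≤ i ^ l)) →
          ∃[ D ] (c < D × M * c ^ l ≤ D ^ l × D ^ l ≤ suc c ^ l * M)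
  close (D , _ , MC≤D^l , below) with above D MC≤D^l
  close (suc D , _ , MC≤D^l , below) | s≤s c≤D = suc D , s≤s c≤D , MC≤D^l , *-cancelˡ-≤ (c ^ l) (begin
    c ^ l * suc D ^ l            ≡⟨ ^-distribʳ-* c (suc D) l ⟨
    (c * suc D) ^ l              ≤⟨ ^-monoˡ-≤ l (≤-trans (≤-reflexive (*-suc c D)) (+-monoˡ-≤ (c * D) c≤D)) ⟩
    (suc c * D) ^ l              ≡⟨ ^-distribʳ-* (suc c) D l ⟩
    suc c ^ l * D ^ l            ≤⟨ *-monoʳ-≤ (suc c ^ l) (<⇒≤ (≰⇒> (below D ≤-refl))) ⟩
    suc c ^ l * (M * c ^ l)      ≡⟨ regroup (suc c ^ l) M (c ^ l) ⟩
    c ^ l * (suc c ^ l * M)      ∎)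
    where
    regroup : ∀ a b c → a * (b * c) ≡ c * (a * b)
    regroup = solve-∀

-- Here l stands for the paper's l minus one, and F for c + 1.
module Parameters (k l B e F D : ℕ) .{{_ : NonZero l}} (4k≤l : 4 * k ≤ l) (e≤Bl : e ≤ B * l)
                  (exponent : 4 * k * l + 4 * k * e ≤ e * l + (B + 1) * l)
                  (D^l≤ : D ^ l ≤ F ^ l * (4 * (2 ^ e * 2 ^ e))) where
  open ≤-Reasoning

  4N² : 4 * (2 ^ e * 2 ^ e) ≡ 2 ^ (2 + (e + e))
  4N² = trans (cong (4 *_) (sym (^-distribˡ-+-* 2 e e))) (sym (^-distribˡ-+-* 2 2 (e + e)))

  -- As e ≤ Bl, the factor (4N²)^(1/l) is bounded. Thus `D` is bounded in terms of c and B alone,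
  -- which keeps the threshold of the chase linear in k.
  D-bound : D ≤ F * 2 ^ (2 + 2 * B)
  D-bound = ^-cancelˡ-≤ l (begin
    D ^ l                           ≤⟨ D^l≤ ⟩
    F ^ l * (4 * (2 ^ e * 2 ^ e))   ≡⟨ cong (F ^ l *_) 4N² ⟩
    F ^ l * 2 ^ (2 + (e + e))       ≤⟨ *-monoʳ-≤ (F ^ l) (^-monoʳ-≤ 2 bound) ⟩
    F ^ l * 2 ^ ((2 + 2 * B) * l)   ≡⟨ cong (F ^ l *_) (^-*-assoc 2 (2 + 2 * B) l) ⟨
    F ^ l * (2 ^ (2 + 2 * B)) ^ l   ≡⟨ ^-distribʳ-* F (2 ^ (2 + 2 * B)) l ⟨
    (F * 2 ^ (2 + 2 * B)) ^ l       ∎)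
    where
    eq : ∀ B l → 2 * l + (B * l + B * l) ≡ (2 + 2 * B) * l
    eq = solve-∀
    bound : 2 + (e + e) ≤ (2 + 2 * B) * l
    bound = begin
      2 + (e + e)               ≤⟨ +-mono-≤ (m≤m*n 2 l) (+-mono-≤ e≤Bl e≤Bl) ⟩
      2 * l + (B * l + B * l)   ≡⟨ eq B l ⟩
      (2 + 2 * B) * l           ∎

  -- The claim is raised to the power l, because only `D ^ l` is controlled. Then the powers of 2
  -- from 4^(2k) and from (4N²)^(2k/l) cancel against N = 2^e up to 2^(B+2). What survives is the
  -- comparison of 2F with 4h, taken 2k times.
  chase-length : ∀ s h → s * 2 ^ (B + 2) * (2 * F) ^ (k + k) ≤ (4 * h) ^ (k + k) →
                 s * (2 * D) ^ (k + k) ≤ 2 ^ e * h ^ (k + k)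
  chase-length s h hyp = ^-cancelˡ-≤ l (*-cancelˡ-≤ ((4 ^ K) ^ l) {{m^n≢0 (4 ^ K) l {{m^n≢0 4 K}}}} (begin
    (4 ^ K) ^ l * (s * (2 * D) ^ K) ^ l
      ≡⟨ cong ((4 ^ K) ^ l *_) (trans (^-distribʳ-* s ((2 * D) ^ K) l) (cong (s ^ l *_) (trans (^-swap (2 * D) K l)
           (trans (cong (_^ K) (^-distribʳ-* 2 D l)) (^-distribʳ-* (2 ^ l) (D ^ l) K))))) ⟩
    (4 ^ K) ^ l * (s ^ l * ((2 ^ l) ^ K * (D ^ l) ^ K))
      ≤⟨ *-monoʳ-≤ ((4 ^ K) ^ l) (*-monoʳ-≤ (s ^ l) (*-monoʳ-≤ ((2 ^ l) ^ K) (^-monoˡ-≤ K D^l≤))) ⟩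
    (4 ^ K) ^ l * (s ^ l * ((2 ^ l) ^ K * (F ^ l * (4 * (2 ^ e * 2 ^ e))) ^ K))
      ≡⟨ cong (λ z → (4 ^ K) ^ l * (s ^ l * ((2 ^ l) ^ K * z))) (^-distribʳ-* (F ^ l) (4 * (2 ^ e * 2 ^ e)) K) ⟩
    (4 ^ K) ^ l * (s ^ l * ((2 ^ l) ^ K * ((F ^ l) ^ K * (4 * (2 ^ e * 2 ^ e)) ^ K)))
      ≡⟨ regroup ((4 ^ K) ^ l) (s ^ l) ((2 ^ l) ^ K) ((F ^ l) ^ K) _ ⟩
    s ^ l * ((2 ^ l) ^ K * (F ^ l) ^ K) * ((4 ^ K) ^ l * (4 * (2 ^ e * 2 ^ e)) ^ K)
      ≡⟨ cong₂ (λ a b → s ^ l * a * b) (trans (sym (^-distribʳ-* (2 ^ l) (F ^ l) K))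
           (trans (cong (_^ K) (sym (^-distribʳ-* 2 F l))) (^-swap (2 * F) l K))) powersOf2 ⟩
    s ^ l * ((2 * F) ^ K) ^ l * 2 ^ (2 * (K * l) + (2 + (e + e)) * K)
      ≤⟨ *-monoʳ-≤ (s ^ l * ((2 * F) ^ K) ^ l) (^-monoʳ-≤ 2 exponent′) ⟩
    s ^ l * ((2 * F) ^ K) ^ l * 2 ^ ((B + 2) * l + e * l)
      ≡⟨ cong (s ^ l * ((2 * F) ^ K) ^ l *_) (trans (^-distribˡ-+-* 2 ((B + 2) * l) (e * l))
           (cong₂ _*_ (sym (^-*-assoc 2 (B + 2) l)) (sym (^-*-assoc 2 e l)))) ⟩
    s ^ l * ((2 * F) ^ K) ^ l * ((2 ^ (B + 2)) ^ l * (2 ^ e) ^ l)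
      ≡⟨ regroup′ (s ^ l) (((2 * F) ^ K) ^ l) ((2 ^ (B + 2)) ^ l) ((2 ^ e) ^ l) ⟩
    s ^ l * (2 ^ (B + 2)) ^ l * ((2 * F) ^ K) ^ l * (2 ^ e) ^ l
      ≡⟨ cong (_* (2 ^ e) ^ l) (trans (cong (_* ((2 * F) ^ K) ^ l) (sym (^-distribʳ-* s (2 ^ (B + 2)) l)))
           (sym (^-distribʳ-* (s * 2 ^ (B + 2)) ((2 * F) ^ K) l))) ⟩
    (s * 2 ^ (B + 2) * (2 * F) ^ K) ^ l * (2 ^ e) ^ l
      ≤⟨ *-monoˡ-≤ ((2 ^ e) ^ l) (^-monoˡ-≤ l hyp) ⟩
    ((4 * h) ^ K) ^ l * (2 ^ e) ^ l
      ≡⟨ cong (_* (2 ^ e) ^ l) (trans (cong (_^ l) (^-distribʳ-* 4 h K)) (^-distribʳ-* (4 ^ K) (h ^ K) l)) ⟩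
    (4 ^ K) ^ l * (h ^ K) ^ l * (2 ^ e) ^ l
      ≡⟨ regroup″ ((4 ^ K) ^ l) ((h ^ K) ^ l) ((2 ^ e) ^ l) ⟩
    (4 ^ K) ^ l * ((2 ^ e) ^ l * (h ^ K) ^ l)
      ≡⟨ cong ((4 ^ K) ^ l *_) (^-distribʳ-* (2 ^ e) (h ^ K) l) ⟨
    (4 ^ K) ^ l * (2 ^ e * h ^ K) ^ l ∎))
    where
    K : ℕ
    K = k + k
    regroup : ∀ a b c d e → a * (b * (c * (d * e))) ≡ b * (c * d) * (a * e)
    regroup = solve-∀
    regroup′ : ∀ a b c d → a * b * (c * d) ≡ a * c * b * d
    regroup′ = solve-∀
    regroup″ : ∀ a b c → a * b * c ≡ a * (c * b)
    regroup″ = solve-∀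
    powersOf2 : (4 ^ K) ^ l * (4 * (2 ^ e * 2 ^ e)) ^ K ≡ 2 ^ (2 * (K * l) + (2 + (e + e)) * K)
    powersOf2 = trans (cong₂ _*_ (trans (^-*-assoc 4 K l) (^-*-assoc 2 2 (K * l)))
                                 (trans (cong (_^ K) 4N²) (^-*-assoc 2 (2 + (e + e)) K)))
                      (sym (^-distribˡ-+-* 2 (2 * (K * l)) ((2 + (e + e)) * K)))
    exponent′ : 2 * (K * l) + (2 + (e + e)) * K ≤ (B + 2) * l + e * l
    exponent′ = begin
      2 * (K * l) + (2 + (e + e)) * K           ≡⟨ eq k l e ⟩
      4 * k + (4 * k * l + 4 * k * e)           ≤⟨ +-mono-≤ 4k≤l exponent ⟩
      l + (e * l + (B + 1) * l)                 ≡⟨ eq′ l e B ⟩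
      (B + 2) * l + e * l                       ∎
      where
      eq : ∀ k l e → 2 * ((k + k) * l) + (2 + (e + e)) * (k + k) ≡ 4 * k + (4 * k * l + 4 * k * e)
      eq = solve-∀
      eq′ : ∀ l e B → l + (e * l + (B + 1) * l) ≡ (B + 2) * l + e * l
      eq′ = solve-∀

-- Bernoulli's inequality (1 + 1/a)^k ≥ 1 + k/a with the 1 dropped.
k*a^k≤a*[1+a]^k : ∀ a k → k * a ^ k ≤ a * suc a ^ k
k*a^k≤a*[1+a]^k a k = ≤-trans (*-monoˡ-≤ (a ^ k) (m≤n+m k a)) (bernoulli k)
  where
  open ≤-Reasoning
  eq : ∀ a k x → (a + (1 + k)) * (a * x) + k * x ≡ (1 + a) * ((a + k) * x)
  eq = solve-∀
  bernoulli : ∀ k → (a + k) * a ^ k ≤ a * suc a ^ k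
  bernoulli zero    = ≤-reflexive (cong (_* 1) (+-identityʳ a))
  bernoulli (suc k) = begin
    (a + suc k) * (a * a ^ k)               ≤⟨ m≤m+n _ (k * a ^ k) ⟩
    (a + suc k) * (a * a ^ k) + k * a ^ k   ≡⟨ eq a k (a ^ k) ⟩
    suc a * ((a + k) * a ^ k)               ≤⟨ *-monoʳ-≤ (suc a) (bernoulli k) ⟩
    suc a * (a * suc a ^ k)                 ≡⟨ x∙yz≈y∙xz (suc a) a (suc a ^ k) ⟩
    a * (suc a * suc a ^ k)                 ∎

-- Splitting the exponent into two halves and applying Bernoulli's inequality to each gives (1 +
-- 1/a)^(2k) ≥ (k/a)², a quadratic lower bound that exceeds Ck.
exponential-beats-linear : ∀ a C k .{{_ : NonZero a}} → a * a * C ≤ k → C * k * a ^ (k + k) ≤ suc a ^ (k + k)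
exponential-beats-linear a C k a²C≤k = *-cancelˡ-≤ (a * a) {{m*n≢0 a a}} (begin
  a * a * (C * k * a ^ (k + k))             ≡⟨ regroup (a * a) C k (a ^ (k + k)) ⟩
  a * a * C * (k * a ^ (k + k))             ≤⟨ *-mono-≤ a²C≤k (≤-reflexive (cong (k *_) (^-distribˡ-+-* a k k))) ⟩
  k * (k * (a ^ k * a ^ k))                 ≡⟨ regroup′ k (a ^ k) ⟩
  k * a ^ k * (k * a ^ k)                   ≤⟨ *-mono-≤ (k*a^k≤a*[1+a]^k a k) (k*a^k≤a*[1+a]^k a k) ⟩
  a * suc a ^ k * (a * suc a ^ k)           ≡⟨ regroup″ a (suc a ^ k) ⟩
  a * a * (suc a ^ k * suc a ^ k)           ≡⟨ cong (a * a *_) (^-distribˡ-+-* (suc a) k k) ⟨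
  a * a * suc a ^ (k + k)                   ∎)
  where
  open ≤-Reasoning
  regroup : ∀ x C k y → x * (C * k * y) ≡ x * C * (k * y)
  regroup = solve-∀
  regroup′ : ∀ k y → k * (k * (y * y)) ≡ k * y * (k * y)
  regroup′ = solve-∀
  regroup″ : ∀ a y → a * y * (a * y) ≡ a * a * (y * y)
  regroup″ = solve-∀

-- e = ⌊4kl/(l - 4k)⌋, so that 2^e approximates 2^(4k/(1 - 4k/l)).
module Exponent (k g₀ B : ℕ) .{{_ : NonZero k}} (l≤Bg : suc (4 * k + g₀) ≤ B * suc g₀) where
  open ≤-Reasoning

  g l₀ l e : ℕ
  g  = suc g₀
  l₀ = 4 * k + g₀
  l  = suc l₀
  e  = (4 * k * l) / g

  e*g≤4kl : e * g ≤ 4 * k * l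
  e*g≤4kl = m/n*n≤m (4 * k * l) g

  4kl≤g+e*g : 4 * k * l ≤ g + e * g
  4kl≤g+e*g = ≤-trans (≤-reflexive (m≡m%n+[m/n]*n (4 * k * l) g)) (+-monoˡ-≤ (e * g) (<⇒≤ (m%n<n (4 * k * l) g)))

  e≤4kB : e ≤ 4 * k * B
  e≤4kB = *-cancelʳ-≤ e (4 * k * B) g (begin
    e * g             ≤⟨ e*g≤4kl ⟩
    4 * k * l         ≤⟨ *-monoʳ-≤ (4 * k) l≤Bg ⟩
    4 * k * (B * g)   ≡⟨ *-assoc (4 * k) B g ⟨
    4 * k * B * g     ∎)

  4k≤l₀ : 4 * k ≤ l₀
  4k≤l₀ = m≤m+n (4 * k) g₀

  e≤Bl₀ : e ≤ B * l₀
  e≤Bl₀ = begin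
    e           ≤⟨ e≤4kB ⟩
    4 * k * B   ≡⟨ *-comm (4 * k) B ⟩
    B * (4 * k) ≤⟨ *-monoʳ-≤ B 4k≤l₀ ⟩
    B * l₀      ∎

  g≤l₀ : g ≤ l₀
  g≤l₀ = +-monoˡ-≤ g₀ (*-mono-≤ {1} {4} (s≤s z≤n) (>-nonZero⁻¹ k))

  -- Without rounding this would be e(l - 4k) = 4kl. The floor costs at most g, and passing from l
  -- to l - 1 costs e; these are at most l₀ and B l₀.
  exponent : 4 * k * l₀ + 4 * k * e ≤ e * l₀ + (B + 1) * l₀
  exponent = begin
    4 * k * l₀ + 4 * k * e             ≤⟨ +-monoˡ-≤ (4 * k * e) (≤-trans (*-monoʳ-≤ (4 * k) (n≤1+n l₀)) 4kl≤g+e*g) ⟩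
    g + e * g + 4 * k * e              ≡⟨ eq g₀ e (4 * k) ⟩
    g + e + e * l₀                     ≤⟨ +-monoˡ-≤ (e * l₀) (+-mono-≤ g≤l₀ e≤Bl₀) ⟩
    l₀ + B * l₀ + e * l₀               ≡⟨ eq′ l₀ B e ⟩
    e * l₀ + (B + 1) * l₀              ∎
    where
    eq : ∀ g e x → (1 + g) + e * (1 + g) + x * e ≡ (1 + g) + e + e * (x + g)
    eq = solve-∀
    eq′ : ∀ l B e → l + B * l + e * l ≡ e * l + (B + 1) * l
    eq′ = solve-∀

-- Folkman graphs for all large k

-- suc g₀ is l - 4k.
EventuallyFolkman : ℕ → Set
EventuallyFolkman B = ∃[ k₀ ] (∀ k g₀ → k₀ < k → suc (4 * k + g₀) ≤ B * suc g₀ →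
    ∃[ e ] (e * suc g₀ ≤ 4 * k * suc (4 * k + g₀) × FolkmanGraphExists k (suc (4 * k + g₀)) (2 ^ e)))

-- c is the numerator of the edge probability and h/c the fraction of the expected degree that is
-- guaranteed; the last two equations say 2(c + 1) : 4h = a : a + 1, so each step of the chase gains.
module Construction (c h r a : ℕ) .{{_ : NonZero c}} .{{_ : NonZero h}} .{{_ : NonZero a}}
                    (2^≤3^ : 2 ^ (2 + h + c) ≤ 3 ^ c) (h<c : h < c)
                    (2[c+1]≡ra : 2 * suc c ≡ r * a) (4h≡r[a+1] : 4 * h ≡ r * suc a) where

  -- The factors of s · 2^(B+2) that do not involve k, with `D` replaced by its bound and 2e + 2 by
  -- (8B + 2)k.
  C : ℕ → ℕ
  C B = 2 * suc h * (suc c * 2 ^ (2 + 2 * B)) * (8 * B + 2) * 2 ^ (B + 2)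

  folkmanGraph-large : ∀ B k g₀ → a * a * C B < k → suc (4 * k + g₀) ≤ B * suc g₀ →
    ∃[ e ] (e * suc g₀ ≤ 4 * k * suc (4 * k + g₀) × FolkmanGraphExists k (suc (4 * k + g₀)) (2 ^ e))
  folkmanGraph-large B k@(suc _) g₀ k>k₀ l≤Bg = e , e*g≤4kl , construct (rootApproximation c l₀ M 1<M)
    where
    open ≤-Reasoning
    open Exponent k g₀ B l≤Bg
    M : ℕ
    M = 4 * (2 ^ e * 2 ^ e)
    1<M : 1 < M
    1<M = *-mono-≤ {2} {4} (s≤s (s≤s z≤n)) (*-mono-≤ (m^n>0 2 e) (m^n>0 2 e))
    instance
      l₀≢0 : NonZero l₀
      l₀≢0 = >-nonZero (≤-trans (s≤s z≤n) g≤l₀)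
    1≤k : 1 ≤ k
    1≤k = s≤s z≤n
    2e+2≤ : 2 * e + 2 ≤ (8 * B + 2) * k
    2e+2≤ = begin
      2 * e + 2                 ≤⟨ +-mono-≤ (*-monoʳ-≤ 2 e≤4kB) (*-monoʳ-≤ 2 1≤k) ⟩
      2 * (4 * k * B) + 2 * k   ≡⟨ eq k B ⟩
      (8 * B + 2) * k           ∎
      where
      eq : ∀ k B → 2 * (4 * k * B) + 2 * k ≡ (8 * B + 2) * k
      eq = solve-∀
    construct : ∃[ D ] (c < D × M * c ^ l₀ ≤ D ^ l₀ × D ^ l₀ ≤ suc c ^ l₀ * M) → FolkmanGraphExists k l (2 ^ e)
    construct (D , c<D , MC≤D^l , D^l≤) with m≤n⇒∃[o]m+o≡n (<⇒≤ c<D)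
    ... | d , refl = folkmanGraph c d h k l₀ e 2^≤3^ (<-trans h<c c<D) MC≤D^l (chase-length s h (begin
      s * 2 ^ (B + 2) * (2 * suc c) ^ K       ≡⟨ cong (s * 2 ^ (B + 2) *_) (trans (cong (_^ K) 2[c+1]≡ra) (^-distribʳ-* r a K)) ⟩
      s * 2 ^ (B + 2) * (r ^ K * a ^ K)       ≤⟨ *-monoˡ-≤ (r ^ K * a ^ K) s-bound ⟩
      C B * k * (r ^ K * a ^ K)               ≡⟨ x∙yz≈y∙xz (C B * k) (r ^ K) (a ^ K) ⟩
      r ^ K * (C B * k * a ^ K)               ≤⟨ *-monoʳ-≤ (r ^ K) (exponential-beats-linear a (C B) k (<⇒≤ k>k₀)) ⟩
      r ^ K * suc a ^ K                       ≡⟨ trans (cong (_^ K) 4h≡r[a+1]) (^-distribʳ-* r (suc a) K) ⟨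
      (4 * h) ^ K                             ∎))
      where
      open Parameters k l₀ B e (suc c) D 4k≤l₀ e≤Bl₀ exponent D^l≤
      K s : ℕ
      K = k + k
      s = 2 * suc h * (D * (2 * e + 2))
      s-bound : s * 2 ^ (B + 2) ≤ C B * k
      s-bound = begin
        2 * suc h * (D * (2 * e + 2)) * 2 ^ (B + 2)
          ≤⟨ *-monoˡ-≤ (2 ^ (B + 2)) (*-monoʳ-≤ (2 * suc h) (*-mono-≤ D-bound 2e+2≤)) ⟩
        2 * suc h * (suc c * 2 ^ (2 + 2 * B) * ((8 * B + 2) * k)) * 2 ^ (B + 2)
          ≡⟨ eq (2 * suc h) (suc c * 2 ^ (2 + 2 * B)) (8 * B + 2) k (2 ^ (B + 2)) ⟩
        C B * k ∎
        where
        eq : ∀ a b c k d → a * (b * (c * k)) * d ≡ a * b * c * d * k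
        eq = solve-∀

  folkmanGraph-eventually : ∀ B → EventuallyFolkman B
  folkmanGraph-eventually B = a * a * C B , folkmanGraph-large B

-- Decidability and the existence of the Folkman number

-- Every graph and every colouring is coded by an upper triangle, so both can be searched exhaustively.
encode : (Fin n → Fin n → Bool) → UpperTriangle n
encode {zero}  f = tt
encode {suc n} f = tabulate (f zero ∘ suc) , encode (λ u v → f (suc u) (suc v))

encode-neighbours : ∀ (f : Fin n → Fin n → Bool) → (∀ u v → f u v ≡ f v u) →
                    ∀ u v → u ≢ v → lookup (neighbours (encode f) u) v ≡ f u v
encode-neighbours f f-symm zero    zero    u≢v = contradiction refl u≢v
encode-neighbours f f-symm zero    (suc v) u≢v = lookup∘tabulate (f zero ∘ suc) v
encode-neighbours f f-symm (suc u) zero    u≢v =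
  trans (lookup∘tabulate (f zero ∘ suc) u) (f-symm zero (suc u))
encode-neighbours f f-symm (suc u) (suc v) u≢v =
  encode-neighbours (λ u v → f (suc u) (suc v)) (λ u v → f-symm (suc u) (suc v)) u v (u≢v ∘ cong suc)

anyUpperTriangle? : ∀ {n} {P : UpperTriangle n → Set} → Decidable P → Dec (∃ P)
anyUpperTriangle? {zero}  P? = map′ (tt ,_) (λ { (tt , p) → p }) (P? tt)
anyUpperTriangle? {suc n} P? =
  map′ (λ { (r , G , p) → (r , G) , p }) (λ { ((r , G) , p) → r , G , p })
       (anySubset? λ r → anyUpperTriangle? λ G → P? (r , G))

anyVec? : ∀ {m} {P : Vec (Fin n) m → Set} → Decidable P → Dec (∃ P)
anyVec? {m = zero}  P? = map′ ([] ,_) (λ { ([] , p) → p }) (P? [])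
anyVec? {m = suc m} P? =
  map′ (λ { (x , xs , p) → x ∷ xs , p }) (λ { (x ∷ xs , p) → x , xs , p })
       (any? λ x → anyVec? λ xs → P? (x ∷ xs))

Pairwise : ∀ {k} → (Fin n → Fin n → Bool) → Bool → (Fin k → Fin n) → Set
Pairwise f b e = ∀ i j → i ≢ j → f (e i) (e j) ≡ b

pairwise? : ∀ {k} f b (e : Fin k → Fin n) → Dec (Pairwise f b e)
pairwise? f b e = all? λ i → all? λ j → ¬? (i Fin.≟ j) →-dec (f (e i) (e j) Bool.≟ b)

pairwise-tabulate : ∀ {k} (f : Fin n → Fin n → Bool) b (e : Fin k → Fin n) →
                    Pairwise f b e → Pairwise f b (lookup (tabulate e))
pairwise-tabulate f b e p i j i≢j rewrite lookup∘tabulate e i | lookup∘tabulate e j = p i j i≢j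

cliqueCopy? : ∀ (G : Graph n) k → Dec (CliqueCopy G k)
cliqueCopy? G k =
  map′ (λ (v , p) → record { emb = lookup v ; emb-inj = adjacent⇒injective G (lookup v) p ; edges = p })
       (λ K → tabulate (emb K) , pairwise-tabulate (adj G) true (emb K) (edges K))
       (anyVec? λ v → pairwise? (adj G) true (lookup v))

monoCliqueCopy? : ∀ (G : Graph n) c k → Dec (MonoCliqueCopy G c k)
monoCliqueCopy? G c k =
  map′ (λ (v , p , b , q) → record
         { copy = record { emb = lookup v ; emb-inj = adjacent⇒injective G (lookup v) p ; edges = p }
         ; col  = b ; mono = q })
       (λ K → tabulate (emb (copy K)) , pairwise-tabulate (adj G) true (emb (copy K)) (edges (copy K))
            , col K , pairwise-tabulate (colour c) (col K) (emb (copy K)) (mono K))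
       (anyVec? λ v → pairwise? (adj G) true (lookup v) ×-dec anyBool? λ b → pairwise? (colour c) b (lookup v))
  where
  anyBool? : ∀ {P : Bool → Set} → Decidable P → Dec (∃ P)
  anyBool? P? with P? true | P? false
  ... | yes p | _     = yes (true , p)
  ... | no _  | yes p = yes (false , p)
  ... | no ¬p | no ¬q = no λ { (true , p) → ¬p p ; (false , q) → ¬q q }

toColouring : ∀ {G : Graph n} → UpperTriangle n → TwoColouring G
toColouring T = record { colour = λ u → lookup (neighbours T u) ; colour-symm = neighbours-symm T }

⟶K? : ∀ (G : Graph n) k → Dec (G ⟶K k)
⟶K? G k with anyUpperTriangle? (λ T → ¬? (monoCliqueCopy? G (toColouring T) k))
... | yes (T , ¬mono) = no λ arrow → ¬mono (arrow (toColouring T))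
... | no  noBad       = yes λ c →
  let code = encode (colour c)
      K    = decidable-stable (monoCliqueCopy? G (toColouring code) k) (λ ¬mono → noBad (code , ¬mono))
  in  record
    { copy = copy K
    ; col  = col K
    -- `encode` forgets the diagonal of the colouring, so the two colourings are compared at
    -- distinct vertices only; injectivity of the copy supplies the distinctness.
    ; mono = λ i j i≢j → trans
        (sym (encode-neighbours (colour c) (colour-symm c) _ _ (i≢j ∘ emb-inj (copy K))))
        (mono K i j i≢j)
    }

-- Decoding an encoded graph restores its adjacency only pointwise, so both properties are carried
-- along pointwise equality.
module _ {G H : Graph n} (G≗H : ∀ u v → adj G u v ≡ adj H u v) where

  cliqueCopy-resp : ∀ {k} → CliqueCopy G k → CliqueCopy H k
  cliqueCopy-resp K = record
    { emb = emb K ; emb-inj = emb-inj K ; edges = λ i j i≢j → trans (sym (G≗H _ _)) (edges K i j i≢j) }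

  ⟶K-resp : ∀ {k} → G ⟶K k → H ⟶K k
  ⟶K-resp arrow c =
    let K = arrow (record { colour = colour c ; colour-symm = colour-symm c })
    in  record { copy = cliqueCopy-resp (copy K) ; col = col K ; mono = mono K }

folkmanGraphExists? : ∀ k l n → Dec (FolkmanGraphExists k l n)
folkmanGraphExists? k l n =
  map′ (λ (T , arrow , free) → toGraph T , arrow , free)
       (λ (G , arrow , free) → encode (adj G) , ⟶K-resp (λ u v → sym (encode-adj G u v)) arrow
                             , free ∘ cliqueCopy-resp (encode-adj G))
       (anyUpperTriangle? λ T → ⟶K? (toGraph T) k ×-dec ¬? (cliqueCopy? (toGraph T) l))
  where
  encode-adj : ∀ (G : Graph n) u v → adj (toGraph (encode (adj G))) u v ≡ adj G u v
  encode-adj G u v with u Fin.≟ v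
  ... | yes refl = trans (neighbours-irrefl (encode (adj G)) u) (sym (irrefl G u))
  ... | no  u≢v  = encode-neighbours (adj G) (symm G) u v u≢v

∃-folkmanNumber : ∀ {k l N} → FolkmanGraphExists k l N → ∃[ f ] (f ≤ N × IsFolkmanNumber k l f)
∃-folkmanNumber {k} {l} {N} exists = least (folkmanGraphExists? k l) N exists

-- From rational upper bounds to the real number α

numerator-bound : ∀ (α : RealIn0¼) {k l} → k ≤ α · l → ∀ q → U α q → k * ↧ₙ q ≤ ℤ.∣ ↥ q ∣ * l
numerator-bound α {k} {l} k≤αl q Uq = ℤ.drop‿+≤+ (begin
  pos (k * ↧ₙ q)            ≡⟨ ℤ.pos-* k (↧ₙ q) ⟩
  pos k ℤ.* ↧ q             ≤⟨ k≤αl q Uq ⟩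
  ↥ q ℤ.* pos l             ≤⟨ ℤ.*-monoʳ-≤-nonNeg (pos l) (i≤∣i∣ (↥ q)) ⟩
  pos ℤ.∣ ↥ q ∣ ℤ.* pos l     ≡⟨ ℤ.pos-* ℤ.∣ ↥ q ∣ l ⟨
  pos (ℤ.∣ ↥ q ∣ * l)       ∎)
  where
  open ℤ.≤-Reasoning
  i≤∣i∣ : ∀ i → i ℤ.≤ pos ℤ.∣ i ∣
  i≤∣i∣ (pos n)        = ℤ.≤-refl
  i≤∣i∣ ℤ.-[1+ n ] = ℤ.-≤+

-- For q = a/b the strict inequality q < 1/4 between integers reads 4a + 1 ≤ b. Multiplying by l and
-- using kb ≤ al gives l ≤ b(l - 4k), so the denominator of q serves as the constant `B`.
gap : ∀ (α : RealIn0¼) {k l} → k ≤ α · l → ∀ q → U α q → q ℚ.< pos 1 ℚ./ 4 → l + ↧ₙ q * (4 * k) ≤ ↧ₙ q * l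
gap α {k} {l} k≤αl q Uq q<¼ = ℤ.drop‿+≤+ (begin
  pos (l + ↧ₙ q * (4 * k))                     ≡⟨ cong (ℤ._+_ (pos l)) (trans (ℤ.pos-* (↧ₙ q) (4 * k)) (cong (↧ q ℤ.*_) (ℤ.pos-* 4 k))) ⟩
  pos l ℤ.+ ↧ q ℤ.* (pos 4 ℤ.* pos k)              ≡⟨ eq (pos l) (↧ q) (pos k) ⟩
  pos l ℤ.+ (pos 4) ℤ.* (pos k ℤ.* ↧ q)            ≤⟨ ℤ.+-monoʳ-≤ (pos l) (ℤ.*-monoˡ-≤-nonNeg (pos 4) (k≤αl q Uq)) ⟩
  pos l ℤ.+ (pos 4) ℤ.* (↥ q ℤ.* pos l)            ≡⟨ eq′ (pos l) (↥ q) ⟩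
  (pos 1 ℤ.+ ↥ q ℤ.* pos 4) ℤ.* pos l              ≤⟨ ℤ.*-monoʳ-≤-nonNeg (pos l) (ℤ.i<j⇒suc[i]≤j (ℚ.drop-*<* q<¼)) ⟩
  (pos 1 ℤ.* ↧ q) ℤ.* pos l                      ≡⟨ cong (ℤ._* pos l) (ℤ.*-identityˡ (↧ q)) ⟩
  ↧ q ℤ.* pos l                                ≡⟨ ℤ.pos-* (↧ₙ q) l ⟨
  pos (↧ₙ q * l)                               ∎)
  where
  open ℤ.≤-Reasoning
  eq : ∀ l b k → l ℤ.+ b ℤ.* (pos 4 ℤ.* k) ≡ l ℤ.+ (pos 4) ℤ.* (k ℤ.* b)
  eq = ℤ.solve-∀
  eq′ : ∀ l a → l ℤ.+ (pos 4) ℤ.* (a ℤ.* l) ≡ (pos 1 ℤ.+ a ℤ.* pos 4) ℤ.* l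
  eq′ = ℤ.solve-∀

-- The function 1/(1 - 4x) is increasing below 1/4 and k/l ≤ a/b, so the bound with k/l implies the
-- one with a/b. Truncated subtraction is harmless: for b ≤ 4a the left side is 0.
exponent-bound : ∀ k l e a b .{{_ : NonZero l}} → e * (l ∸ 4 * k) ≤ 4 * k * l → k * b ≤ a * l →
                 e * (b ∸ 4 * a) ≤ 4 * k * b
exponent-bound k l e a b e-bound kb≤al = *-cancelʳ-≤ _ _ l (begin
  e * (b ∸ 4 * a) * l              ≡⟨ *-assoc e (b ∸ 4 * a) l ⟩
  e * ((b ∸ 4 * a) * l)            ≡⟨ cong (e *_) (*-distribʳ-∸ l b (4 * a)) ⟩
  e * (b * l ∸ 4 * a * l)          ≤⟨ *-monoʳ-≤ e (∸-monoʳ-≤ (b * l) 4bk≤4al) ⟩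
  e * (b * l ∸ b * (4 * k))        ≡⟨ cong (e *_) (*-distribˡ-∸ b l (4 * k)) ⟨
  e * (b * (l ∸ 4 * k))            ≡⟨ x∙yz≈y∙xz e b (l ∸ 4 * k) ⟩
  b * (e * (l ∸ 4 * k))            ≤⟨ *-monoʳ-≤ b e-bound ⟩
  b * (4 * k * l)                  ≡⟨ regroup′ b (4 * k) l ⟩
  4 * k * b * l                    ∎)
  where
  open ≤-Reasoning
  regroup′ : ∀ a b c → a * (b * c) ≡ b * a * c
  regroup′ = solve-∀
  eq : ∀ b k → b * (4 * k) ≡ 4 * (k * b)
  eq = solve-∀
  4bk≤4al : b * (4 * k) ≤ 4 * a * l
  4bk≤4al = begin
    b * (4 * k)   ≡⟨ eq b k ⟩
    4 * (k * b)   ≤⟨ *-monoʳ-≤ 4 kb≤al ⟩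
    4 * (a * l)   ≡⟨ *-assoc 4 a l ⟨
    4 * a * l     ∎

bounded : ∀ (α : RealIn0¼) {k l e f} .{{_ : NonZero l}} → k ≤ α · l → e * (l ∸ 4 * k) ≤ 4 * k * l → f ≤ 2 ^ e →
          BoundedBy2^4k/1-4α f k α
bounded α {k} {l} {e} {f} k≤αl e-bound f≤2^e q Uq _ = begin
  f ^ (b ∸ 4 * a)         ≤⟨ ^-monoˡ-≤ (b ∸ 4 * a) f≤2^e ⟩
  (2 ^ e) ^ (b ∸ 4 * a)   ≡⟨ ^-*-assoc 2 e (b ∸ 4 * a) ⟩
  2 ^ (e * (b ∸ 4 * a))   ≤⟨ ^-monoʳ-≤ 2 (exponent-bound k l e a b e-bound (numerator-bound α {k} {l} k≤αl q Uq)) ⟩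
  2 ^ (4 * k * b)         ∎
  where
  open ≤-Reasoning
  a b : ℕ
  a = ℤ.∣ ↥ q ∣
  b = ↧ₙ q

4k<l : ∀ B k l .{{_ : NonZero B}} .{{_ : NonZero k}} → l + B * (4 * k) ≤ B * l → 4 * k < l
4k<l B@(suc _) k@(suc _) zero    hyp = contradiction (≤-trans hyp (≤-reflexive (*-zeroʳ B))) λ ()
4k<l B         k         (suc l) hyp =
  *-cancelˡ-< B _ _ (<-≤-trans (m<n+m (B * (4 * k)) (s≤s z≤n)) hyp)

-- One rational p fixes `B` and k₀ for all k and l at once. The exponent e, in contrast, depends on
-- k/l and not on p; therefore the final bound holds for every rational in the cut, and not merely
-- for p.
fromEventually : ∀ α p → U α p → p ℚ.< pos 1 ℚ./ 4 → EventuallyFolkman (↧ₙ p) →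
  ∃[ k₀ ] (∀ (k l : ℕ) → k ≥ k₀ → k ≤ α · l → ∃[ f ] (IsFolkmanNumber k l f × BoundedBy2^4k/1-4α f k α))
fromEventually α p Up p<¼ (k₀ , folkmanGraphExists) = suc k₀ , folkman
  where
  open ≤-Reasoning
  B = ↧ₙ p
  folkman : ∀ k l → k ≥ suc k₀ → k ≤ α · l → ∃[ f ] (IsFolkmanNumber k l f × BoundedBy2^4k/1-4α f k α)
  folkman k@(suc _) l k>k₀ k≤αl
    with gap′ ← gap α {k} {l} k≤αl p Up p<¼
    with g₀ , refl ← m≤n⇒∃[o]m+o≡n (4k<l B k l gap′) =
    let e , e-bound , exists = folkmanGraphExists k g₀ k>k₀ (+-cancelʳ-≤ (B * (4 * k)) _ _ (begin
          suc (4 * k + g₀) + B * (4 * k)   ≤⟨ gap′ ⟩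
          B * suc (4 * k + g₀)             ≡⟨ cong (B *_) (l≡g+4k k g₀) ⟩
          B * (suc g₀ + 4 * k)             ≡⟨ *-distribˡ-+ B (suc g₀) (4 * k) ⟩
          B * suc g₀ + B * (4 * k)         ∎))
        f , f≤2^e , isFolkmanNumber = ∃-folkmanNumber exists
    in  f , isFolkmanNumber , bounded α {k} {e = e} k≤αl
          (subst (λ g → e * g ≤ 4 * k * suc (4 * k + g₀)) (sym (l∸4k≡g k g₀)) e-bound) f≤2^e
    where
    l≡g+4k : ∀ k g₀ → suc (4 * k + g₀) ≡ suc g₀ + 4 * k
    l≡g+4k k g₀ = cong suc (+-comm (4 * k) g₀)
    l∸4k≡g : ∀ k g₀ → suc (4 * k + g₀) ∸ 4 * k ≡ suc g₀
    l∸4k≡g k g₀ = trans (cong (_∸ 4 * k) (l≡g+4k k g₀)) (m+n∸n≡m (suc g₀) (4 * k))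

-- 3^64 ≥ 2^101, and 2 · 65 = 10 · 13, 4 · 35 = 10 · 14.
theorem1p2 : (α : RealIn0¼) → ∃[ k₀ ] (∀ (k l : ℕ) → k ≥ k₀ → k ≤ α · l → ∃[ f ] (IsFolkmanNumber k l f × BoundedBy2^4k/1-4α f k α))
theorem1p2 α =
  let p , p<¼ , Up = rounded α (below¼ α)
  in  fromEventually α p Up p<¼
        (Construction.folkmanGraph-eventually 64 35 10 13 (≤ᵇ⇒≤ _ _ tt) (≤ᵇ⇒≤ _ _ tt) refl refl (↧ₙ p))
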